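{- Let $n\geq 3$ and $\tau$ be integers, and put $\sigma=n^{2}-\tau$. Suppose there is an integer $k\geq 1$ with $kn\leq\sigma\leq(k+1)n$, $\sigma-kn\equiv 0 \pmod{k+1}$ and $(k+1)n-\sigma\equiv 0\pmod{k}$. Then $$\mu(n,\tau)=((k+1)!)^{\frac{\sigma-kn}{k+1}}\times(k!)^{\frac{(k+1)n-\sigma}{k}}.$$ Moreover, for $A\in\mathscr{U}(n,\tau)$, ${\rm per}A=\mu(n,\tau)$ if and only if $A$ is combinatorially equivalent to the matrix $$K_{n,\sigma}=J_{k+1}\oplus J_{k+1}\oplus\cdots\oplus J_{k+1}\oplus J_{k}\oplus\cdots\oplus J_{k}\in\mathscr{U}(n,\tau),$$ the direct sum of $\frac{\sigma-kn}{k+1}$ copies of $J_{k+1}$ and $\frac{(k+1)n-\sigma}{k}$ copies of $J_k$.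
   Context: For an $n\times n$ matrix $M=[a_{ij}]$, ${\rm per}M=\sum_{\phi}\prod_{i=1}^{n}a_{i\phi(i)}$, the sum over all permutations $\phi$ of $\{1,\dots,n\}$. $\mathscr{U}(n,\tau)$ is the set of all $(0,1)$-matrices of order $n$ with exactly $\tau$ entries equal to $0$ (hence exactly $\sigma=n^2-\tau$ entries equal to $1$), and $\mu(n,\tau)=\max\{{\rm per}A: A\in\mathscr{U}(n,\tau)\}$. $J_m$ denotes the $m\times m$ all-ones matrix and $\oplus$ the direct sum of matrices. Two matrices $A,B$ are combinatorially equivalent if $B=PAQ$ for some permutation matrices $P,Q$. -}

module Defs where

open import Data.Nat using (ℕ; zero; suc; _+_; _*_)
open import Data.Bool using (Bool; true; false; if_then_else_; _∧_; _∨_; not)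
open import Data.Fin using (Fin; zero; suc; splitAt)
open import Data.Fin.Properties using (_≟_)
open import Data.Sum using (inj₁; inj₂)
open import Data.List using (List; []; _∷_; map; concatMap; replicate; _++_)
open import Data.Nat.ListAction using (sum)
open import Data.Vec.Functional as VF using (Vector)
open import Relation.Nullary.Decidable using (⌊_⌋)
open import Relation.Binary.PropositionalEquality using (_≡_)
open import Function.Bundles using (_↔_; Inverse)
open import Data.Product using (Σ; _×_)
open import Data.Nat using (_≤_)

Mat : ℕ → Set
Mat n = Fin n → Fin n → Bool

b2n : Bool → ℕ
b2n true = 1
b2n false = 0

sumFin : (n : ℕ) → (Fin n → ℕ) → ℕ
sumFin zero f = 0
sumFin (suc n) f = f zero + sumFin n (λ i → f (suc i))

prodFin : (n : ℕ) → (Fin n → ℕ) → ℕ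
prodFin zero f = 1
prodFin (suc n) f = f zero * prodFin n (λ i → f (suc i))

andFin : (n : ℕ) → (Fin n → Bool) → Bool
andFin zero f = true
andFin (suc n) f = f zero ∧ andFin n (λ i → f (suc i))

allFuns : (m n : ℕ) → List (Fin m → Fin n)
allFuns zero n = (λ ()) ∷ []
allFuns (suc m) n = concatMap (λ f → map (λ x → x VF.∷ f) (allFin' n)) (allFuns m n)
  where
  allFin' : (n : ℕ) → List (Fin n)
  allFin' zero = []
  allFin' (suc n) = zero ∷ map suc (allFin' n)

isPerm : (n : ℕ) → (Fin n → Fin n) → Bool
isPerm n φ = andFin n (λ i → andFin n (λ j → not ⌊ φ i ≟ φ j ⌋ ∨ ⌊ i ≟ j ⌋))

per : {n : ℕ} → Mat n → ℕ
per {n} A = sum (map (λ φ → if isPerm n φ then prodFin n (λ i → b2n (A i (φ i))) else 0)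
                     (allFuns n n))

zeros : {n : ℕ} → Mat n → ℕ
zeros {n} A = sumFin n (λ i → sumFin n (λ j → b2n (not (A i j))))

InU : (n τ : ℕ) → Mat n → Set
InU n τ A = zeros A ≡ τ

IsMu : (n τ m : ℕ) → Set
IsMu n τ m = Σ (Mat n) (λ A → InU n τ A × per A ≡ m)
           × ((A : Mat n) → InU n τ A → per A ≤ m)

J : (m : ℕ) → Mat m
J m i j = true

_⊕_ : {m p : ℕ} → Mat m → Mat p → Mat (m + p)
_⊕_ {m} A B i j with splitAt m i | splitAt m j
... | inj₁ i' | inj₁ j' = A i' j'
... | inj₂ i' | inj₂ j' = B i' j'
... | inj₁ _  | inj₂ _  = false
... | inj₂ _  | inj₁ _  = false

blockDiag : (sizes : List ℕ) → Mat (sum sizes)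
blockDiag [] = λ ()
blockDiag (s ∷ ss) = J s ⊕ blockDiag ss

Ksizes : (k a b : ℕ) → List ℕ
Ksizes k a b = replicate a (suc k) ++ replicate b k

Kmat : (k a b : ℕ) → Mat (sum (Ksizes k a b))
Kmat k a b = blockDiag (Ksizes k a b)

-- combinatorial equivalence: B = P A Q for permutation matrices P, Q,
-- i.e. bijections p, q of the index sets with B (p i) (q j) = A i j
CombEquiv : {n m : ℕ} → Mat n → Mat m → Set
CombEquiv {n} {m} A B = Σ (Fin n ↔ Fin m) (λ p → Σ (Fin n ↔ Fin m) (λ q →
  (i j : Fin n) → B (Inverse.to p i) (Inverse.to q j) ≡ A i j))

fact : ℕ → ℕ
fact zero = 1
fact (suc n) = suc n * fact n

pow : ℕ → ℕ → ℕ
pow x zero = 1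
pow x (suc e) = x * pow x e

{-# OPTIONS --safe #-}
module Submission where

-- The proof combines Brègman's inequality per A ≤ ∏ᵢ (rᵢ !)^(1/rᵢ), rᵢ the row sums of A, with the strict
-- concavity of log (r !) / r, by which row sums k and k + 1, and only these, maximize the right-hand side.
-- To stay in ℕ, everything is raised to the power L = N !, with w r = (r !)^(L / r) a natural number.
-- Brègman's inequality follows Schrijver: the cofactors p i k = a i k · per (minor A i k) have all row and
-- column sums equal to P = per A, so the entropy bound P^P ≤ (rᵢ)^P ∏ₖ (p i k)^(p i k), the induction
-- hypothesis for the minors and an exchange of products give P^(L P n) ≤ (∏ᵢ w rᵢ)^(P n).
-- In case of equality every minor at a one of A is again extremal and has nonzero permanent; inductively it
-- has no 2 × 2 submatrix with exactly three ones, hence neither has A. Moving a transversal of ones to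
-- the diagonal turns such an A into an equivalence relation, whose classes are the blocks of K.

open import Defs
open import Algebra.Properties.CommutativeMonoid.Sum as MonoidSum using ()
open import Algebra.Properties.Semiring.Sum as SemiringSum using ()
open import Data.Bool using (Bool; true; false; if_then_else_; _∧_; _∨_; not)
open import Data.Fin using (Fin; zero; suc; punchIn; punchOut; splitAt; join; _↑ˡ_; _↑ʳ_)
open import Data.Fin.Permutation as Perm using (Permutation; _⟨$⟩ʳ_; _⟨$⟩ˡ_; inverseʳ)
open import Data.Fin.Properties
  using (_≟_; suc-injective; punchIn-injective; punchInᵢ≢i; punchIn-punchOut;
         splitAt-↑ˡ; splitAt-↑ʳ; splitAt-join; +↔⊎)
open import Data.List using (List; []; _∷_; _++_; concatMap; map; replicate)
open import Data.List.Properties using (map-++; map-∘)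
open import Data.List.Relation.Unary.All using (All; []; _∷_)
open import Data.Nat hiding (_≟_)
open import Data.Nat.Divisibility using (divides; ∣-trans; m∣m*n; m≤n⇒m!∣n!)
open import Data.Nat.DivMod using (_/_; m/n*n≡m)
open import Data.Nat.ListAction using (sum)
open import Data.Nat.ListAction.Properties using (sum-++)
open import Data.Nat.Properties as ℕₚ hiding (_≟_; suc-injective)
open import Data.Nat.Tactic.RingSolver using (solve-∀)
open import Data.Product using (∃; ∃₂; Σ; _,_; _×_; proj₁; proj₂)
open import Data.Sum as Sum using (_⊎_; inj₁; inj₂)
open import Data.Sum.Function.Propositional using (_⊎-↔_)
open import Data.Sum.Properties using (swap-↔)
open import Data.Vec.Functional as VF using ()
open import Function using (_∘_; id; _↔_; mk↔ₛ′; Inverse)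
open import Function.Bundles using (_⇔_; mk⇔)
open import Function.Construct.Composition using (_↔-∘_)
open import Function.Construct.Identity using (↔-id)
open import Function.Construct.Symmetry using (↔-sym)
open import Relation.Binary.Definitions using (tri<; tri≈; tri>)
open import Relation.Binary.PropositionalEquality hiding (J)
open import Relation.Nullary using (contradiction; yes; no)
open import Relation.Nullary.Decidable using (⌊_⌋)

-- The equality case shapes the proof of the bound: each estimate is kept as a product of local
-- factors, because two products of positive numbers that are compared factor by factor and agree
-- must agree in every factor. For this purpose the entropy bound is applied with the number of
-- nonzero cofactors in row i instead of rᵢ. Passing to rᵢ is then a factor of its own, and equality
-- in it says that every one of A has a nonzero cofactor. The exponent L must be common to a matrix
-- and all its minors, so N is fixed before the induction on the order. The two equality conditions
-- complement each other: Brègman's inequality yields the block structure, concavity yields the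
-- block sizes k and k + 1, and the number of ones then determines how many blocks of each size
-- there are.

private
  module ΣF = SemiringSum +-*-semiring
  module ΠF = MonoidSum *-1-commutativeMonoid

  variable
    m n : ℕ

-- Finite sums and products

sumFin≡sum : ∀ n f → sumFin n f ≡ ΣF.sum f
sumFin≡sum zero f = refl
sumFin≡sum (suc n) f = cong (f zero +_) (sumFin≡sum n (f ∘ suc))

prodFin≡sum : ∀ n f → prodFin n f ≡ ΠF.sum f
prodFin≡sum zero f = refl
prodFin≡sum (suc n) f = cong (f zero *_) (prodFin≡sum n (f ∘ suc))

sum-cong : ∀ n {f g : Fin n → ℕ} → (∀ i → f i ≡ g i) → sumFin n f ≡ sumFin n g
sum-cong zero e = refl
sum-cong (suc n) e = cong₂ _+_ (e zero) (sum-cong n (e ∘ suc))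

prod-cong : ∀ n {f g : Fin n → ℕ} → (∀ i → f i ≡ g i) → prodFin n f ≡ prodFin n g
prod-cong zero e = refl
prod-cong (suc n) e = cong₂ _*_ (e zero) (prod-cong n (e ∘ suc))

sum-+ : ∀ n (f g : Fin n → ℕ) → sumFin n (λ i → f i + g i) ≡ sumFin n f + sumFin n g
sum-+ n f g = trans (sumFin≡sum n _)
  (trans (ΣF.∑-distrib-+ f g) (sym (cong₂ _+_ (sumFin≡sum n f) (sumFin≡sum n g))))

prod-* : ∀ n (f g : Fin n → ℕ) → prodFin n (λ i → f i * g i) ≡ prodFin n f * prodFin n g
prod-* n f g = trans (prodFin≡sum n _)
  (trans (ΠF.∑-distrib-+ f g) (sym (cong₂ _*_ (prodFin≡sum n f) (prodFin≡sum n g))))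

sum-*ˡ : ∀ n c (f : Fin n → ℕ) → sumFin n (λ i → c * f i) ≡ c * sumFin n f
sum-*ˡ n c f = trans (sumFin≡sum n _)
  (trans (sym (ΣF.*-distribˡ-sum c f)) (cong (c *_) (sym (sumFin≡sum n f))))

sum-const : ∀ n c → sumFin n (λ _ → c) ≡ n * c
sum-const zero c = refl
sum-const (suc n) c = cong (c +_) (sum-const n c)

prod-const : ∀ n c → prodFin n (λ _ → c) ≡ c ^ n
prod-const zero c = refl
prod-const (suc n) c = cong (c *_) (prod-const n c)

sum-swap : ∀ m n (f : Fin m → Fin n → ℕ) →
  sumFin m (λ i → sumFin n (f i)) ≡ sumFin n (λ j → sumFin m (λ i → f i j))
sum-swap m n f = begin
  sumFin m (λ i → sumFin n (f i))            ≡⟨ sum-cong m (λ i → sumFin≡sum n (f i)) ⟩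
  sumFin m (λ i → ΣF.sum (f i))              ≡⟨ sumFin≡sum m _ ⟩
  ΣF.sum (λ i → ΣF.sum (f i))                ≡⟨ ΣF.∑-comm f ⟩
  ΣF.sum (λ j → ΣF.sum (λ i → f i j))        ≡⟨ sumFin≡sum n _ ⟨
  sumFin n (λ j → ΣF.sum (λ i → f i j))      ≡⟨ sum-cong n (λ j → sumFin≡sum m (λ i → f i j)) ⟨
  sumFin n (λ j → sumFin m (λ i → f i j))    ∎
  where open ≡-Reasoning

prod-swap : ∀ m n (f : Fin m → Fin n → ℕ) →
  prodFin m (λ i → prodFin n (f i)) ≡ prodFin n (λ j → prodFin m (λ i → f i j))
prod-swap m n f = begin
  prodFin m (λ i → prodFin n (f i))            ≡⟨ prod-cong m (λ i → prodFin≡sum n (f i)) ⟩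
  prodFin m (λ i → ΠF.sum (f i))               ≡⟨ prodFin≡sum m _ ⟩
  ΠF.sum (λ i → ΠF.sum (f i))                  ≡⟨ ΠF.∑-comm f ⟩
  ΠF.sum (λ j → ΠF.sum (λ i → f i j))          ≡⟨ prodFin≡sum n _ ⟨
  prodFin n (λ j → ΠF.sum (λ i → f i j))       ≡⟨ prod-cong n (λ j → prodFin≡sum m (λ i → f i j)) ⟨
  prodFin n (λ j → prodFin m (λ i → f i j))    ∎
  where open ≡-Reasoning

sum-punchIn : ∀ n i (f : Fin (suc n) → ℕ) → sumFin (suc n) f ≡ f i + sumFin n (f ∘ punchIn i)
sum-punchIn n i f = trans (sumFin≡sum (suc n) f)
  (trans (ΣF.sum-remove f) (cong (f i +_) (sym (sumFin≡sum n _))))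

prod-punchIn : ∀ n i (f : Fin (suc n) → ℕ) → prodFin (suc n) f ≡ f i * prodFin n (f ∘ punchIn i)
prod-punchIn n i f = trans (prodFin≡sum (suc n) f)
  (trans (ΠF.sum-remove f) (cong (f i *_) (sym (prodFin≡sum n _))))

sum-permute : ∀ m n (π : Permutation m n) f → sumFin n f ≡ sumFin m (f ∘ (π ⟨$⟩ʳ_))
sum-permute m n π f = trans (sumFin≡sum n f) (trans (ΣF.sum-permute f π) (sym (sumFin≡sum m _)))

^-distribʳ-* : ∀ e x y → (x * y) ^ e ≡ x ^ e * y ^ e
^-distribʳ-* zero x y = refl
^-distribʳ-* (suc e) x y = trans (cong (x * y *_) (^-distribʳ-* e x y)) (shuffle x y (x ^ e) (y ^ e))
  where
  shuffle : ∀ a b c d → a * b * (c * d) ≡ a * c * (b * d)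
  shuffle = solve-∀

^-swap : ∀ x a b → (x ^ a) ^ b ≡ (x ^ b) ^ a
^-swap x a b = trans (^-*-assoc x a b) (trans (cong (x ^_) (*-comm a b)) (sym (^-*-assoc x b a)))

prod-^ : ∀ n e (f : Fin n → ℕ) → prodFin n (λ i → f i ^ e) ≡ prodFin n f ^ e
prod-^ zero e f = sym (^-zeroˡ e)
prod-^ (suc n) e f = trans (cong (f zero ^ e *_) (prod-^ n e (f ∘ suc))) (sym (^-distribʳ-* e (f zero) _))

^-sum : ∀ n x (f : Fin n → ℕ) → prodFin n (λ i → x ^ f i) ≡ x ^ sumFin n f
^-sum zero x f = refl
^-sum (suc n) x f = trans (cong (x ^ f zero *_) (^-sum n x (f ∘ suc))) (sym (^-distribˡ-+-* x (f zero) _))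

sum-mono-≤ : ∀ n {f g : Fin n → ℕ} → (∀ i → f i ≤ g i) → sumFin n f ≤ sumFin n g
sum-mono-≤ zero p = z≤n
sum-mono-≤ (suc n) p = +-mono-≤ (p zero) (sum-mono-≤ n (p ∘ suc))

prod-mono-≤ : ∀ n {f g : Fin n → ℕ} → (∀ i → f i ≤ g i) → prodFin n f ≤ prodFin n g
prod-mono-≤ zero p = ≤-refl
prod-mono-≤ (suc n) p = *-mono-≤ (p zero) (prod-mono-≤ n (p ∘ suc))

prod-pos : ∀ n {f : Fin n → ℕ} → (∀ i → 0 < f i) → 0 < prodFin n f
prod-pos zero p = s≤s z≤n
prod-pos (suc n) p = *-mono-≤ (p zero) (prod-pos n (p ∘ suc))

term≤sum : ∀ n (f : Fin n → ℕ) i → f i ≤ sumFin n f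
term≤sum (suc n) f zero = m≤m+n (f zero) _
term≤sum (suc n) f (suc i) = ≤-trans (term≤sum n (f ∘ suc) i) (m≤n+m _ (f zero))

sum-pos⇒term-pos : ∀ n (f : Fin n → ℕ) → 0 < sumFin n f → ∃ λ i → 0 < f i
sum-pos⇒term-pos (suc n) f p with f zero in eq
... | suc _ = zero , subst (0 <_) (sym eq) (s≤s z≤n)
... | zero with sum-pos⇒term-pos n (f ∘ suc) p
...   | i , q = suc i , q

sum-≤-reflect : ∀ n {f g : Fin n → ℕ} → (∀ i → f i ≤ g i) → sumFin n g ≤ sumFin n f → ∀ i → g i ≤ f i
sum-≤-reflect (suc n) p q zero = ≮⇒≥ λ lt → <⇒≱ (+-mono-<-≤ lt (sum-mono-≤ n (p ∘ suc))) q
sum-≤-reflect (suc n) p q (suc i) = sum-≤-reflect n (p ∘ suc)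
  (≮⇒≥ λ lt → <⇒≱ (+-mono-≤-< (p zero) lt) q) i

*-mono-<-≤ : ∀ {a b c d} → a < b → c ≤ d → 0 < c → a * c < b * d
*-mono-<-≤ {a} {b} {c} {d} lt le pos = <-≤-trans (*-monoˡ-< c {{>-nonZero pos}} lt) (*-monoʳ-≤ b le)

*-mono-≤-< : ∀ {a b c d} → a ≤ b → c < d → 0 < a → a * c < b * d
*-mono-≤-< {a} {b} {c} {d} le lt pos = subst₂ _<_ (*-comm c a) (*-comm d b) (*-mono-<-≤ lt le pos)

*-≤-reflect : ∀ {a b c d} → a ≤ b → c ≤ d → 0 < a → 0 < c → b * d ≤ a * c → b ≤ a × d ≤ c
*-≤-reflect p q a>0 c>0 r =
  ≮⇒≥ (λ lt → <⇒≱ (*-mono-<-≤ lt q c>0) r) , ≮⇒≥ (λ lt → <⇒≱ (*-mono-≤-< p lt a>0) r)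

prod-≤-reflect : ∀ n {f g : Fin n → ℕ} → (∀ i → f i ≤ g i) → (∀ i → 0 < f i) →
  prodFin n g ≤ prodFin n f → ∀ i → g i ≤ f i
prod-≤-reflect (suc n) p pos q i
  with *-≤-reflect (p zero) (prod-mono-≤ n (p ∘ suc)) (pos zero) (prod-pos n (pos ∘ suc)) q
prod-≤-reflect (suc n) p pos q zero | a , b = a
prod-≤-reflect (suc n) p pos q (suc i) | a , b = prod-≤-reflect n (p ∘ suc) (pos ∘ suc) b i

^-pos : ∀ {x} e → 0 < x → 0 < x ^ e
^-pos {x} e p = m^n>0 x {{>-nonZero p}} e

^-cancel-≤ : ∀ {x y} e → 0 < e → x ^ e ≤ y ^ e → x ≤ y
^-cancel-≤ {x} {y} e p q = ≮⇒≥ λ lt → <⇒≱ (^-monoˡ-< e {{>-nonZero p}} lt) q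

^-cancel-< : ∀ {x y} e → x ^ e < y ^ e → x < y
^-cancel-< {x} {y} e q = ≰⇒> λ le → <⇒≱ q (^-monoˡ-≤ e le)

-- Permanents: cofactor expansion and invariance

-- A record type is rigid in `xs`, so the list in `Enumerates n _` can be found by unification; the
-- bare equation would mention it only under `map`.
record Enumerates (n : ℕ) (xs : List (Fin n)) : Set where
  constructor enumerates
  field sum-map : ∀ F → sum (map F xs) ≡ sumFin n F
open Enumerates

enum-step : ∀ {n} xs → Enumerates n xs → Enumerates (suc n) (zero ∷ map suc xs)
enum-step xs (enumerates e) = enumerates λ F →
  cong (F zero +_) (trans (cong sum (sym (map-∘ xs))) (e (λ i → F (suc i))))

sum-concatMap : ∀ {A B : Set} (F : B → ℕ) (g : A → List B) xs →
  sum (map F (concatMap g xs)) ≡ sum (map (λ x → sum (map F (g x))) xs)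
sum-concatMap F g [] = refl
sum-concatMap F g (x ∷ xs) = trans (cong sum (map-++ F (g x) _)) (trans (sum-++ (map F (g x)) _)
  (cong (sum (map F (g x)) +_) (sum-concatMap F g xs)))

sum-map-cong : ∀ {A : Set} {f g : A → ℕ} → (∀ x → f x ≡ g x) → ∀ xs → sum (map f xs) ≡ sum (map g xs)
sum-map-cong e [] = refl
sum-map-cong e (x ∷ xs) = cong₂ _+_ (e x) (sum-map-cong e xs)

cons-sum : ∀ {m n} (F : (Fin (suc m) → Fin n) → ℕ) {xs} → Enumerates n xs → ∀ fs →
  sum (map F (concatMap (λ f → map (λ x → x VF.∷ f) xs) fs)) ≡
  sum (map (λ f → sumFin n (λ x → F (x VF.∷ f))) fs)
cons-sum F {xs} e fs = trans (sum-concatMap F _ fs)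
  (sum-map-cong (λ f → trans (cong sum (sym (map-∘ xs))) (sum-map e (λ x → F (x VF.∷ f)))) fs)

-- The list of indices in allFuns is a local function allFin' m n k, which only occurs with k equal to n
-- or, after one unfolding, with n equal to suc k. Abstracting suc n separates the two arguments, so that
-- the underscores below can be solved by it and the induction on k goes through.
mutual
  sum-allFuns-suc : ∀ m n (F : (Fin (suc m) → Fin n) → ℕ) →
    sum (map F (allFuns (suc m) n)) ≡ sum (map (λ f → sumFin n (λ x → F (x VF.∷ f))) (allFuns m n))
  allFin-enumerates-suc : ∀ m n → Enumerates n _
  allFin-enumerates : ∀ m w n → Enumerates n _

  sum-allFuns-suc m zero F = cons-sum F (enumerates λ _ → refl) (allFuns m zero)
  sum-allFuns-suc m (suc n) F = cons-sum F (enum-step _ (allFin-enumerates-suc m n)) (allFuns m (suc n))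

  allFin-enumerates-suc m n with suc n
  ... | w = allFin-enumerates m w n

  allFin-enumerates m w zero = enumerates λ _ → refl
  allFin-enumerates m w (suc n) = enum-step _ (allFin-enumerates m w n)

sum-map-sumFin : ∀ {A : Set} n (G : A → Fin n → ℕ) xs →
  sum (map (λ x → sumFin n (G x)) xs) ≡ sumFin n (λ i → sum (map (λ x → G x i) xs))
sum-map-sumFin n G [] = sym (trans (sum-const n 0) (*-zeroʳ n))
sum-map-sumFin n G (x ∷ xs) =
  trans (cong (sumFin n (G x) +_) (sum-map-sumFin n G xs)) (sym (sum-+ n (G x) _))

sumFuns : ∀ m n → ((Fin m → Fin n) → ℕ) → ℕ
sumFuns m n F = sum (map F (allFuns m n))

sumFuns-suc : ∀ m n F → sumFuns (suc m) n F ≡ sumFin n (λ x → sumFuns m n (λ f → F (x VF.∷ f)))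
sumFuns-suc m n F = trans (sum-allFuns-suc m n F) (sum-map-sumFin n _ (allFuns m n))

sumFuns-cong : ∀ m n {F G} → (∀ f → F f ≡ G f) → sumFuns m n F ≡ sumFuns m n G
sumFuns-cong m n e = sum-map-cong e (allFuns m n)

sumFuns-zero : ∀ m n {F} → (∀ f → F f ≡ 0) → sumFuns m n F ≡ 0
sumFuns-zero m n e = trans (sumFuns-cong m n e) (sum-map-0 (allFuns m n))
  where
  sum-map-0 : ∀ {A : Set} (xs : List A) → sum (map (λ _ → 0) xs) ≡ 0
  sum-map-0 [] = refl
  sum-map-0 (x ∷ xs) = sum-map-0 xs

sumFuns-*ˡ : ∀ m n c F → sumFuns m n (λ f → c * F f) ≡ c * sumFuns m n F
sumFuns-*ˡ m n c F = go (allFuns m n)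
  where
  go : ∀ xs → sum (map (λ f → c * F f) xs) ≡ c * sum (map F xs)
  go [] = sym (*-zeroʳ c)
  go (x ∷ xs) = trans (cong (c * F x +_) (go xs)) (sym (*-distribˡ-+ c (F x) _))

Extensional : ((Fin m → Fin n) → ℕ) → Set
Extensional F = ∀ {f g} → (∀ i → f i ≡ g i) → F f ≡ F g

∷-cong : ∀ {x y : Fin n} {f g : Fin m → Fin n} → x ≡ y → (∀ i → f i ≡ g i) → ∀ i → (x VF.∷ f) i ≡ (y VF.∷ g) i
∷-cong p q zero = p
∷-cong p q (suc i) = q i

-- Functions that miss the value `x` factor through `punchIn x`, and all other terms vanish.
-- `Extensional` is required because the two constructions of such a function agree only pointwise.
sumFuns-avoid : ∀ m n x (F : (Fin m → Fin (suc n)) → ℕ) → Extensional F →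
  (∀ f i → f i ≡ x → F f ≡ 0) → sumFuns m (suc n) F ≡ sumFuns m n (λ g → F (punchIn x ∘ g))
sumFuns-avoid zero n x F ext avoid = cong (_+ 0) (ext λ ())
sumFuns-avoid (suc m) n x F ext avoid = begin
  sumFuns (suc m) (suc n) F
    ≡⟨ sumFuns-suc m (suc n) F ⟩
  sumFin (suc n) (λ y → sumFuns m (suc n) (λ f → F (y VF.∷ f)))
    ≡⟨ sum-punchIn n x (λ y → sumFuns m (suc n) (λ f → F (y VF.∷ f))) ⟩
  sumFuns m (suc n) (λ f → F (x VF.∷ f)) + sumFin n (λ y → sumFuns m (suc n) (λ f → F (punchIn x y VF.∷ f)))
    ≡⟨ cong₂ _+_ (sumFuns-zero m (suc n) (λ f → avoid _ zero refl)) (sum-cong n step) ⟩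
  sumFin n (λ y → sumFuns m n (λ g → F (punchIn x ∘ (y VF.∷ g))))
    ≡⟨ sumFuns-suc m n (λ g → F (punchIn x ∘ g)) ⟨
  sumFuns (suc m) n (λ g → F (punchIn x ∘ g)) ∎
  where
  open ≡-Reasoning
  push : ∀ {m} y (g : Fin m → Fin n) i → (punchIn x y VF.∷ (punchIn x ∘ g)) i ≡ punchIn x ((y VF.∷ g) i)
  push y g zero = refl
  push y g (suc i) = refl
  step : ∀ y → sumFuns m (suc n) (λ f → F (punchIn x y VF.∷ f)) ≡ sumFuns m n (λ g → F (punchIn x ∘ (y VF.∷ g)))
  step y = trans (sumFuns-avoid m n x (λ f → F (punchIn x y VF.∷ f)) (λ e → ext (∷-cong refl e))
      (λ f i → avoid _ (suc i)))
    (sumFuns-cong m n (λ g → ext (push y g)))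

andFin-elim : ∀ n {f} → andFin n f ≡ true → ∀ i → f i ≡ true
andFin-elim (suc n) {f} e i with f zero in eq
andFin-elim (suc n) e zero | true = eq
andFin-elim (suc n) e (suc i) | true = andFin-elim n e i

andFin-intro : ∀ n {f} → (∀ i → f i ≡ true) → andFin n f ≡ true
andFin-intro zero e = refl
andFin-intro (suc n) e = cong₂ _∧_ (e zero) (andFin-intro n (e ∘ suc))

andFin-cong : ∀ n {f g} → (∀ i → f i ≡ g i) → andFin n f ≡ andFin n g
andFin-cong zero e = refl
andFin-cong (suc n) e = cong₂ _∧_ (e zero) (andFin-cong n (e ∘ suc))

isPerm-sound : ∀ n φ → isPerm n φ ≡ true → ∀ {i j} → φ i ≡ φ j → i ≡ j
isPerm-sound n φ e {i} {j} eq with φ i ≟ φ j | i ≟ j | andFin-elim n (andFin-elim n e i) j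
... | yes _ | yes i≡j | _ = i≡j
... | no φi≢φj | _ | _ = contradiction eq φi≢φj

isPerm-complete : ∀ n {φ} → (∀ {i j} → φ i ≡ φ j → i ≡ j) → isPerm n φ ≡ true
isPerm-complete n {φ} inj = andFin-intro n λ i → andFin-intro n λ j → entry i j
  where
  entry : ∀ i j → not ⌊ φ i ≟ φ j ⌋ ∨ ⌊ i ≟ j ⌋ ≡ true
  entry i j with φ i ≟ φ j | i ≟ j
  ... | no _ | _ = refl
  ... | yes _ | yes _ = refl
  ... | yes eq | no i≢j = contradiction (inj eq) i≢j

isPerm-cong : ∀ n {φ ψ} → (∀ i → φ i ≡ ψ i) → isPerm n φ ≡ isPerm n ψ
isPerm-cong n e = andFin-cong n λ i → andFin-cong n λ j →
  cong₂ (λ x y → not ⌊ x ≟ y ⌋ ∨ ⌊ i ≟ j ⌋) (e i) (e j)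

⇔-≡ : ∀ {a b} → (a ≡ true → b ≡ true) → (b ≡ true → a ≡ true) → a ≡ b
⇔-≡ {true} p q = sym (p refl)
⇔-≡ {false} {true} p q = q refl
⇔-≡ {false} {false} p q = refl

isPerm-∷ : ∀ n x (g : Fin n → Fin n) → isPerm (suc n) (x VF.∷ (punchIn x ∘ g)) ≡ isPerm n g
isPerm-∷ n x g = ⇔-≡
  (λ e → isPerm-complete n λ eq → suc-injective (isPerm-sound (suc n) (x VF.∷ (punchIn x ∘ g)) e
      (cong (punchIn x) eq)))
  (λ e → isPerm-complete (suc n) λ {i} {j} → inj e i j)
  where
  inj : isPerm n g ≡ true → ∀ i j → (x VF.∷ (punchIn x ∘ g)) i ≡ (x VF.∷ (punchIn x ∘ g)) j → i ≡ j
  inj e zero zero eq = refl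
  inj e zero (suc j) eq = contradiction (sym eq) (punchInᵢ≢i x (g j))
  inj e (suc i) zero eq = contradiction eq (punchInᵢ≢i x (g i))
  inj e (suc i) (suc j) eq = cong suc (isPerm-sound n g e (punchIn-injective x (g i) (g j) eq))

minor : Mat (suc n) → Fin (suc n) → Fin (suc n) → Mat n
minor A i j k l = A (punchIn i k) (punchIn j l)

-- The permanent by expansion along row zero. All inductions run on this form; `per≡perm` links it
-- to the sum over permutations.
perm : ∀ n → Mat n → ℕ
perm zero A = 1
perm (suc n) A = sumFin (suc n) (λ k → b2n (A zero k) * perm n (minor A zero k))

weight : ∀ n → Mat n → (Fin n → Fin n) → ℕ
weight n A φ = if isPerm n φ then prodFin n (λ i → b2n (A i (φ i))) else 0

weight-cong : ∀ n A → Extensional (weight n A)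
weight-cong n A {f} {g} e rewrite isPerm-cong n e =
  cong (if isPerm n g then_else 0) (prod-cong n λ i → cong (b2n ∘ A i) (e i))

weight-∷ : ∀ n A x g → weight (suc n) A (x VF.∷ (punchIn x ∘ g)) ≡ b2n (A zero x) * weight n (minor A zero x) g
weight-∷ n A x g rewrite isPerm-∷ n x g with isPerm n g
... | true = refl
... | false = sym (*-zeroʳ (b2n (A zero x)))

weight-collision : ∀ n A x f i → f i ≡ x → weight (suc n) A (x VF.∷ f) ≡ 0
weight-collision n A x f i eq with isPerm (suc n) (x VF.∷ f) in e
... | false = refl
... | true with isPerm-sound (suc n) (x VF.∷ f) e {suc i} {zero} eq
...   | ()

per≡perm : ∀ n A → per A ≡ perm n A
per≡perm zero A = refl
per≡perm (suc n) A = trans (sumFuns-suc n (suc n) (weight (suc n) A)) (sum-cong (suc n) row)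
  where
  row : ∀ x → sumFuns n (suc n) (λ f → weight (suc n) A (x VF.∷ f)) ≡ b2n (A zero x) * perm n (minor A zero x)
  row x = begin
    sumFuns n (suc n) (λ f → weight (suc n) A (x VF.∷ f))
      ≡⟨ sumFuns-avoid n n x _ (λ e → weight-cong (suc n) A (∷-cong refl e)) (weight-collision n A x) ⟩
    sumFuns n n (λ g → weight (suc n) A (x VF.∷ (punchIn x ∘ g)))
      ≡⟨ sumFuns-cong n n (weight-∷ n A x) ⟩
    sumFuns n n (λ g → b2n (A zero x) * weight n (minor A zero x) g)
      ≡⟨ sumFuns-*ˡ n n (b2n (A zero x)) (weight n (minor A zero x)) ⟩
    b2n (A zero x) * per (minor A zero x)
      ≡⟨ cong (b2n (A zero x) *_) (per≡perm n (minor A zero x)) ⟩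
    b2n (A zero x) * perm n (minor A zero x) ∎
    where open ≡-Reasoning

perm-cong : ∀ n {A B : Mat n} → (∀ i j → A i j ≡ B i j) → perm n A ≡ perm n B
perm-cong zero e = refl
perm-cong (suc n) e = sum-cong (suc n) λ k →
  cong₂ _*_ (cong b2n (e zero k)) (perm-cong n λ i j → e (suc i) (punchIn k j))

cofactor : Mat (suc n) → Fin (suc n) → Fin (suc n) → ℕ
cofactor {n} A i j = b2n (A i j) * perm n (minor A i j)

sum-*-swap : ∀ m n (a : Fin m → ℕ) (b : Fin n → ℕ) (c : Fin m → Fin n → ℕ) →
  sumFin m (λ i → a i * sumFin n (λ j → b j * c i j)) ≡ sumFin n (λ j → b j * sumFin m (λ i → a i * c i j))
sum-*-swap m n a b c = begin
  sumFin m (λ i → a i * sumFin n (λ j → b j * c i j))    ≡⟨ sum-cong m (λ i → sum-*ˡ n (a i) _) ⟨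
  sumFin m (λ i → sumFin n (λ j → a i * (b j * c i j)))  ≡⟨ sum-swap m n _ ⟩
  sumFin n (λ j → sumFin m (λ i → a i * (b j * c i j)))
    ≡⟨ sum-cong n (λ j → sum-cong m (λ i → shuffle (a i) (b j) (c i j))) ⟩
  sumFin n (λ j → sumFin m (λ i → b j * (a i * c i j)))  ≡⟨ sum-cong n (λ j → sum-*ˡ m (b j) _) ⟩
  sumFin n (λ j → b j * sumFin m (λ i → a i * c i j))    ∎
  where
  open ≡-Reasoning
  shuffle : ∀ x y z → x * (y * z) ≡ y * (x * z)
  shuffle = solve-∀

-- Expanding the minors of row zero along their column zero gives a double sum over a further row
-- and a further column. Read in the other order it is the expansion along column zero, since both
-- orders of deletion give definitionally equal minors.
perm-col-zero : ∀ n (A : Mat (suc n)) → perm (suc n) A ≡ sumFin (suc n) (λ i → cofactor A i zero)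
perm-col-zero zero A = refl
perm-col-zero (suc n) A = cong (cofactor A zero zero +_) (begin
  sumFin (suc n) (λ k → b2n (A zero (suc k)) * perm (suc n) (minor A zero (suc k)))
    ≡⟨ sum-cong (suc n) (λ k → cong (b2n (A zero (suc k)) *_) (perm-col-zero n (minor A zero (suc k)))) ⟩
  sumFin (suc n) (λ k → b2n (A zero (suc k)) * sumFin (suc n) (λ l → b2n (A (suc l) zero) * perm n
      (minor (minor A zero (suc k)) l zero)))
    ≡⟨ sum-*-swap (suc n) (suc n) (λ k → b2n (A zero (suc k))) (λ l → b2n (A (suc l) zero))
        (λ k l → perm n (minor (minor A zero (suc k)) l zero)) ⟩
  sumFin (suc n) (λ l → b2n (A (suc l) zero) * perm (suc n) (minor A (suc l) zero)) ∎)
  where open ≡-Reasoning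

_ᵀ : Mat n → Mat n
(A ᵀ) i j = A j i

perm-ᵀ : ∀ n (A : Mat n) → perm n (A ᵀ) ≡ perm n A
perm-ᵀ zero A = refl
perm-ᵀ (suc n) A = trans (sum-cong (suc n) λ k → cong (b2n (A k zero) *_) (perm-ᵀ n (minor A k zero)))
  (sym (perm-col-zero n A))

-- The position of i after the deletion of punchIn i l: the pairs (i , l) and
-- (punchIn i l , repunch i l) describe the same two distinct indices, in both orders.
repunch : Fin (suc (suc n)) → Fin (suc n) → Fin (suc n)
repunch zero l = zero
repunch (suc i) zero = i
repunch {suc n} (suc i) (suc l) = suc (repunch i l)

punchIn-repunch : ∀ (i : Fin (suc (suc n))) l → punchIn (punchIn i l) (repunch i l) ≡ i
punchIn-repunch zero l = refl
punchIn-repunch (suc i) zero = refl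
punchIn-repunch {suc n} (suc i) (suc l) = cong suc (punchIn-repunch i l)

punchIn-punchIn : ∀ (i : Fin (suc (suc n))) l x →
  punchIn (punchIn i l) (punchIn (repunch i l) x) ≡ punchIn i (punchIn l x)
punchIn-punchIn zero l x = refl
punchIn-punchIn (suc i) zero x = refl
punchIn-punchIn (suc i) (suc l) zero = refl
punchIn-punchIn (suc i) (suc l) (suc x) = cong suc (punchIn-punchIn i l x)

-- After expansion along column zero, row `i` survives in every minor but one, at the position
-- `repunch i l`. By induction these minors are expanded along it, and exchanging the sums collects
-- the terms by the entries of row `i`.
perm-row : ∀ n (A : Mat (suc n)) i → perm (suc n) A ≡ sumFin (suc n) (cofactor A i)
perm-row zero A zero = refl
perm-row (suc n) A i = begin
  perm (2 + n) A
    ≡⟨ perm-col-zero (suc n) A ⟩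
  sumFin (2 + n) (λ l → cofactor A l zero)
    ≡⟨ sum-punchIn (suc n) i (λ l → cofactor A l zero) ⟩
  cofactor A i zero + sumFin (suc n) (λ l → b2n (A (punchIn i l) zero) * perm (suc n) (minor A (punchIn i l)
      zero))
    ≡⟨ cong (cofactor A i zero +_) (sum-cong (suc n) (λ l → cong (b2n (A (punchIn i l) zero) *_) (expand l))) ⟩
  cofactor A i zero + sumFin (suc n) (λ l → b2n (A (punchIn i l) zero) *
    sumFin (suc n) (λ k → b2n (A i (suc k)) * perm n (minor (minor A i (suc k)) l zero)))
    ≡⟨ cong (cofactor A i zero +_) (sum-*-swap (suc n) (suc n) (λ l → b2n (A (punchIn i l) zero))
        (λ k → b2n (A i (suc k)))
        (λ l k → perm n (minor (minor A i (suc k)) l zero))) ⟩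
  cofactor A i zero + sumFin (suc n) (λ k → b2n (A i (suc k)) *
    sumFin (suc n) (λ l → cofactor (minor A i (suc k)) l zero))
    ≡⟨ cong (cofactor A i zero +_) (sum-cong (suc n) (λ k → cong (b2n (A i (suc k)) *_) (perm-col-zero n
        (minor A i (suc k))))) ⟨
  sumFin (2 + n) (cofactor A i) ∎
  where
  open ≡-Reasoning
  expand : ∀ l → perm (suc n) (minor A (punchIn i l) zero) ≡
    sumFin (suc n) (λ k → b2n (A i (suc k)) * perm n (minor (minor A i (suc k)) l zero))
  expand l = trans (perm-row n (minor A (punchIn i l) zero) (repunch i l))
    (sum-cong (suc n) λ k → cong₂ _*_ (cong (λ r → b2n (A r (suc k))) (punchIn-repunch i l))
      (perm-cong n λ x y → cong (λ r → A r (suc (punchIn k y))) (punchIn-punchIn i l x)))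

perm-col : ∀ n (A : Mat (suc n)) j → perm (suc n) A ≡ sumFin (suc n) (λ i → cofactor A i j)
perm-col n A j = begin
  perm (suc n) A                         ≡⟨ perm-ᵀ (suc n) A ⟨
  perm (suc n) (A ᵀ)                     ≡⟨ perm-row n (A ᵀ) j ⟩
  sumFin (suc n) (cofactor (A ᵀ) j)
    ≡⟨ sum-cong (suc n) (λ i → cong (b2n (A i j) *_) (perm-ᵀ n (minor A i j))) ⟩
  sumFin (suc n) (λ i → cofactor A i j)  ∎
  where open ≡-Reasoning

-- Row zero of `A` becomes row `p ⟨$⟩ʳ zero` of `B`, which is why expansion along an arbitrary row
-- is wanted; the minors are matched by `p` and `q` with one point removed.
perm-permute : ∀ m n (A : Mat m) (B : Mat n) (p q : Permutation m n) →
  (∀ i j → B (p ⟨$⟩ʳ i) (q ⟨$⟩ʳ j) ≡ A i j) → perm m A ≡ perm n B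
perm-permute zero zero A B p q e = refl
perm-permute zero (suc n) A B p q e = contradiction p (Perm.refute λ ())
perm-permute (suc m) zero A B p q e = contradiction p (Perm.refute λ ())
perm-permute (suc m) (suc n) A B p q e = begin
  sumFin (suc m) (cofactor A zero)
    ≡⟨ sum-cong (suc m) entry ⟩
  sumFin (suc m) (λ k → cofactor B (p ⟨$⟩ʳ zero) (q ⟨$⟩ʳ k))
    ≡⟨ sum-permute (suc m) (suc n) q (cofactor B (p ⟨$⟩ʳ zero)) ⟨
  sumFin (suc n) (cofactor B (p ⟨$⟩ʳ zero))
    ≡⟨ perm-row n B (p ⟨$⟩ʳ zero) ⟨
  perm (suc n) B ∎
  where
  open ≡-Reasoning
  entry : ∀ k → cofactor A zero k ≡ cofactor B (p ⟨$⟩ʳ zero) (q ⟨$⟩ʳ k)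
  entry k = cong₂ _*_ (cong b2n (sym (e zero k)))
    (perm-permute m n (minor A zero k) (minor B (p ⟨$⟩ʳ zero) (q ⟨$⟩ʳ k)) (Perm.remove zero p) (Perm.remove k q)
      λ i j → trans (sym (cong₂ B (Perm.punchIn-permute p zero i) (Perm.punchIn-permute q k j)))
          (e (suc i) (punchIn k j)))

-- The entropy bound

2xy≤x²+y² : ∀ x y → 2 * (x * y) ≤ x * x + y * y
2xy≤x²+y² x y with ≤-total x y
... | inj₁ x≤y with m≤n⇒∃[o]m+o≡n x≤y
...   | d , refl = subst (2 * (x * (x + d)) ≤_) (eq x d) (m≤m+n _ (d * d))
  where
  eq : ∀ x d → 2 * (x * (x + d)) + d * d ≡ x * x + (x + d) * (x + d)
  eq = solve-∀
2xy≤x²+y² x y | inj₂ y≤x with m≤n⇒∃[o]m+o≡n y≤x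
...   | d , refl = subst (2 * ((y + d) * y) ≤_) (eq y d) (m≤m+n _ (d * d))
  where
  eq : ∀ y d → 2 * ((y + d) * y) + d * d ≡ (y + d) * (y + d) + y * y
  eq = solve-∀

-- AM-GM for one `u ^ suc n` and `n` copies of `v ^ suc n`. The step combines `u` times the previous
-- case with `suc n * v ^ n` times `2xy≤x²+y²`; a mixed term is added on both sides to avoid
-- subtraction.
young : ∀ n u v → suc n * (u * v ^ n) ≤ u ^ suc n + n * v ^ suc n
young zero u v = ≤-refl
young (suc n) u v = +-cancelʳ-≤ (n * (u * (v * X))) _ _ (begin
  (2 + n) * (u * (v * X)) + n * (u * (v * X))     ≡⟨ e₁ n u v X ⟩
  suc n * X * (2 * (u * v))                       ≤⟨ *-monoʳ-≤ (suc n * X) (2xy≤x²+y² u v) ⟩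
  suc n * X * (u * u + v * v)                     ≡⟨ e₂ n u v X ⟩
  u * (suc n * (u * X)) + suc n * (v * (v * X))   ≤⟨ +-monoˡ-≤ _ (*-monoʳ-≤ u (young n u v)) ⟩
  u * (Y + n * (v * X)) + suc n * (v * (v * X))   ≡⟨ e₃ n u v X Y ⟩
  u * Y + suc n * (v * (v * X)) + n * (u * (v * X)) ∎)
  where
  open ≤-Reasoning
  X = v ^ n
  Y = u ^ suc n
  e₁ : ∀ n u v X → (2 + n) * (u * (v * X)) + n * (u * (v * X)) ≡ suc n * X * (2 * (u * v))
  e₁ = solve-∀
  e₂ : ∀ n u v X → suc n * X * (u * u + v * v) ≡ u * (suc n * (u * X)) + suc n * (v * (v * X))
  e₂ = solve-∀
  e₃ : ∀ n u v X Y → u * (Y + n * (v * X)) + suc n * (v * (v * X)) ≡ u * Y + suc n * (v * (v * X)) + n *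
      (u * (v * X))
  e₃ = solve-∀

-- Young's inequality for the two means u = (S + x) / (1 + T) and v = S / T, cleared of denominators.
amgm-mean : ∀ T S x → suc T ^ suc T * (x * S ^ T) ≤ T ^ T * (S + x) ^ suc T
amgm-mean zero S x = ≤-trans (≤-reflexive (e x)) (≤-trans (m≤n+m x S) (≤-reflexive (e′ (S + x))))
  where
  e : ∀ x → 1 * (x * 1) ≡ x
  e = solve-∀
  e′ : ∀ y → y ≡ 1 * (y * 1)
  e′ = solve-∀
amgm-mean T@(suc _) S x = *-cancelˡ-≤ T (+-cancelʳ-≤ (T * V ^ suc T) _ _ (begin
  T * (suc T ^ suc T * (x * S ^ T)) + T * V ^ suc T
    ≡⟨ cong (λ z → T * (suc T ^ suc T * (x * S ^ T)) + T * (V * z)) (^-distribʳ-* T (suc T) S) ⟩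
  T * (suc T ^ suc T * (x * S ^ T)) + T * (V * (suc T ^ T * S ^ T))
    ≡⟨ e₁ T S x (suc T ^ T) (S ^ T) ⟩
  suc T * (U * (suc T ^ T * S ^ T))
    ≡⟨ cong (λ z → suc T * (U * z)) (^-distribʳ-* T (suc T) S) ⟨
  suc T * (U * V ^ T)
    ≤⟨ young T U V ⟩
  U ^ suc T + T * V ^ suc T
    ≡⟨ cong (_+ T * V ^ suc T) (^-distribʳ-* (suc T) T (S + x)) ⟩
  T * T ^ T * (S + x) ^ suc T + T * V ^ suc T
    ≡⟨ cong (_+ T * V ^ suc T) (*-assoc T (T ^ T) _) ⟩
  T * (T ^ T * (S + x) ^ suc T) + T * V ^ suc T ∎))
  where
  open ≤-Reasoning
  U = T * (S + x)
  V = suc T * S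
  e₁ : ∀ T S x a b → T * (suc T * a * (x * b)) + T * (suc T * S * (a * b)) ≡ suc T * (T * (S + x) * (a * b))
  e₁ = solve-∀

n^n>0 : ∀ n → 0 < n ^ n
n^n>0 zero = s≤s z≤n
n^n>0 n@(suc _) = m^n>0 n n

-- `S` and `Q` stand for the sum and the product of `T` numbers, to which `x` is adjoined.
amgm-step : ∀ T S Q x → T ^ T * Q ≤ S ^ T → suc T ^ suc T * (x * Q) ≤ (x + S) ^ suc T
amgm-step T S Q x h = *-cancelˡ-≤ (T ^ T) {{>-nonZero (n^n>0 T)}} (begin
  T ^ T * (suc T ^ suc T * (x * Q))  ≡⟨ e (T ^ T) (suc T ^ suc T) x Q ⟩
  suc T ^ suc T * (x * (T ^ T * Q))  ≤⟨ *-monoʳ-≤ (suc T ^ suc T) (*-monoʳ-≤ x h) ⟩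
  suc T ^ suc T * (x * S ^ T)        ≤⟨ amgm-mean T S x ⟩
  T ^ T * (S + x) ^ suc T            ≡⟨ cong (λ y → T ^ T * y ^ suc T) (+-comm S x) ⟩
  T ^ T * (x + S) ^ suc T            ∎)
  where
  open ≤-Reasoning
  e : ∀ a b x Q → a * (b * (x * Q)) ≡ b * (x * (a * Q))
  e = solve-∀

amgm-repeat : ∀ a T S Q x → T ^ T * Q ≤ S ^ T → (a + T) ^ (a + T) * (x ^ a * Q) ≤ (a * x + S) ^ (a + T)
amgm-repeat zero T S Q x h = ≤-trans (≤-reflexive (cong (T ^ T *_) (+-identityʳ Q))) h
amgm-repeat (suc a) T S Q x h = begin
  suc (a + T) ^ suc (a + T) * (x * x ^ a * Q)    ≡⟨ cong (suc (a + T) ^ suc (a + T) *_) (*-assoc x (x ^ a) Q) ⟩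
  suc (a + T) ^ suc (a + T) * (x * (x ^ a * Q))
    ≤⟨ amgm-step (a + T) (a * x + S) (x ^ a * Q) x (amgm-repeat a T S Q x h) ⟩
  (x + (a * x + S)) ^ suc (a + T)                ≡⟨ cong (_^ suc (a + T)) (+-assoc x (a * x) S) ⟨
  (x + a * x + S) ^ suc (a + T)                  ∎
  where open ≤-Reasoning

weighted-amgm : ∀ n (t x : Fin n → ℕ) →
  sumFin n t ^ sumFin n t * prodFin n (λ i → x i ^ t i) ≤ sumFin n (λ i → t i * x i) ^ sumFin n t
weighted-amgm zero t x = ≤-refl
weighted-amgm (suc n) t x = amgm-repeat (t zero) _ _ _ (x zero) (weighted-amgm n (t ∘ suc) (x ∘ suc))

sg : ℕ → ℕ
sg zero = 0
sg (suc _) = 1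

-- Weighted AM-GM for the numbers 1 / t i with weights t i, scaled by a common multiple of the t i.
entropy-bound : ∀ n (t : Fin n → ℕ) →
  sumFin n t ^ sumFin n t ≤ sumFin n (sg ∘ t) ^ sumFin n t * prodFin n (λ i → t i ^ t i)
entropy-bound n t = *-cancelʳ-≤ _ _ (C ^ T) {{>-nonZero (^-pos T (1≤n! T))}} (begin
  T ^ T * C ^ T
    ≡⟨ cong (T ^ T *_) powers ⟨
  T ^ T * (prodFin n (λ i → x i ^ t i) * prodFin n (λ i → t i ^ t i))
    ≡⟨ *-assoc (T ^ T) _ _ ⟨
  T ^ T * prodFin n (λ i → x i ^ t i) * prodFin n (λ i → t i ^ t i)
    ≤⟨ *-monoˡ-≤ _ (weighted-amgm n t x) ⟩
  sumFin n (λ i → t i * x i) ^ T * prodFin n (λ i → t i ^ t i)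
    ≡⟨ cong (λ z → z ^ T * prodFin n (λ i → t i ^ t i)) (trans (sum-cong n tx) (sum-*ˡ n C (sg ∘ t))) ⟩
  (C * s) ^ T * prodFin n (λ i → t i ^ t i)
    ≡⟨ cong (_* prodFin n (λ i → t i ^ t i)) (^-distribʳ-* T C s) ⟩
  C ^ T * s ^ T * prodFin n (λ i → t i ^ t i)
    ≡⟨ e (C ^ T) (s ^ T) _ ⟩
  s ^ T * prodFin n (λ i → t i ^ t i) * C ^ T ∎)
  where
  open ≤-Reasoning
  T = sumFin n t
  s = sumFin n (sg ∘ t)
  C = T !
  cofactor-of : ∀ u → u ≤ T → ∃ λ y → u * y ≡ C * sg u
  -- A weight 0 may carry the value 0: it adds nothing to the sum, and to the product it contributes
  -- 0 ^ 0 = 1.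
  cofactor-of zero u≤T = 0 , sym (*-zeroʳ C)
  cofactor-of (suc u) u≤T with ∣-trans (m∣m*n (u !)) (m≤n⇒m!∣n! u≤T)
  ... | divides q eq = q , trans (*-comm (suc u) q) (trans (sym eq) (sym (*-identityʳ C)))
  x : Fin n → ℕ
  x i = proj₁ (cofactor-of (t i) (term≤sum n t i))
  tx : ∀ i → t i * x i ≡ C * sg (t i)
  tx i = proj₂ (cofactor-of (t i) (term≤sum n t i))
  sg-pow : ∀ u → (C * sg u) ^ u ≡ C ^ u
  sg-pow zero = refl
  sg-pow (suc u) = cong (_^ suc u) (*-identityʳ C)
  powers : prodFin n (λ i → x i ^ t i) * prodFin n (λ i → t i ^ t i) ≡ C ^ T
  powers = trans (sym (prod-* n _ _)) (trans
    (prod-cong n λ i → trans (sym (^-distribʳ-* (t i) (x i) (t i)))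
      (trans (cong (_^ t i) (trans (*-comm (x i) (t i)) (tx i))) (sg-pow (t i))))
    (^-sum n C t))
  e : ∀ a b c → a * b * c ≡ b * c * a
  e = solve-∀

-- Brègman's inequality

rowSum : ∀ n → Mat n → Fin n → ℕ
rowSum n A i = sumFin n (λ j → b2n (A i j))

rowSum≤n : ∀ n (A : Mat n) i → rowSum n A i ≤ n
rowSum≤n n A i = ≤-trans (sum-mono-≤ n λ j → b2n≤1 (A i j)) (≤-reflexive (trans (sum-const n 1)
  (*-identityʳ n)))
  where
  b2n≤1 : ∀ b → b2n b ≤ 1
  b2n≤1 true = ≤-refl
  b2n≤1 false = z≤n

-- The left-hand side speaks only of a row and a column of `A`. Products over the rows of a minor
-- thus become products over the rows of `A` other than `i`, as the exchange in `prod-Y` demands.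
rowSum-minor : ∀ n (A : Mat (suc n)) i k l →
  rowSum (suc n) A (punchIn i l) ∸ b2n (A (punchIn i l) k) ≡ rowSum n (minor A i k) l
rowSum-minor n A i k l = trans (cong (_∸ b2n (A (punchIn i l) k)) (sum-punchIn n k (λ j → b2n (A (punchIn i l)
  j))))
  (m+n∸m≡n (b2n (A (punchIn i l) k)) _)

b2n-*-pos : ∀ {b c} → 0 < b2n b * c → b ≡ true × 0 < c
b2n-*-pos {true} {c} p = refl , subst (0 <_) (+-identityʳ c) p

perm-pos⇒row : ∀ n (A : Mat (suc n)) → 0 < perm (suc n) A →
  ∀ i → ∃ λ j → A i j ≡ true × 0 < perm n (minor A i j)
perm-pos⇒row n A pos i with sum-pos⇒term-pos (suc n) (cofactor A i) (subst (0 <_) (perm-row n A i) pos)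
... | j , p = j , b2n-*-pos p

perm-pos⇒col : ∀ n (A : Mat (suc n)) → 0 < perm (suc n) A →
  ∀ j → ∃ λ i → A i j ≡ true × 0 < perm n (minor A i j)
perm-pos⇒col n A pos j with sum-pos⇒term-pos (suc n) (λ i → cofactor A i j) (subst (0 <_) (perm-col n A j) pos)
... | i , p = i , b2n-*-pos p

perm-pos⇒rowSum-pos : ∀ n (A : Mat (suc n)) → 0 < perm (suc n) A → ∀ i → 0 < rowSum (suc n) A i
perm-pos⇒rowSum-pos n A pos i with perm-pos⇒row n A pos i
... | j , e , _ = ≤-trans (≤-reflexive (sym (cong b2n e))) (term≤sum (suc n) (λ j → b2n (A i j)) j)

n≡0∨n>0 : ∀ n → n ≡ 0 ⊎ 0 < n
n≡0∨n>0 zero = inj₁ refl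
n≡0∨n>0 (suc n) = inj₂ (s≤s z≤n)

-- Equivalently, two rows with a common one are equal.
Rectangular : Mat n → Set
Rectangular A = ∀ {i i′ j j′} → A i j ≡ true → A i′ j ≡ true → A i j′ ≡ true → A i′ j′ ≡ true

Rectangular-off : ∀ (A : Mat (suc n)) s t → Rectangular (minor A s t) →
  ∀ {i i′ j j′} → s ≢ i → s ≢ i′ → t ≢ j → t ≢ j′ →
  A i j ≡ true → A i′ j ≡ true → A i j′ ≡ true → A i′ j′ ≡ true
Rectangular-off A s t rect {i} {i′} {j} {j′} s≢i s≢i′ t≢j t≢j′ a b c =
  trans (sym (entry s≢i′ t≢j′)) (rect (trans (entry s≢i t≢j) a) (trans (entry s≢i′ t≢j) b)
      (trans (entry s≢i t≢j′) c))
  where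
  entry : ∀ {k l} (s≢k : s ≢ k) (t≢l : t ≢ l) → minor A s t (punchOut s≢k) (punchOut t≢l) ≡ A k l
  entry s≢k t≢l = cong₂ A (punchIn-punchOut s≢k) (punchIn-punchOut t≢l)

true≢false : ∀ {b} → b ≡ true → b ≡ false → ∀ {X : Set} → X
true≢false refl ()

perm-pos⇒ones-around-zero : ∀ n (A : Mat (suc n)) → 0 < perm (suc n) A → ∀ {i j} → A i j ≡ false →
  ∃₂ λ p q → p ≢ i × q ≢ j × A i q ≡ true × A p j ≡ true
perm-pos⇒ones-around-zero n A pos {i} {j} A≡false
  with q , Aiq , _ ← perm-pos⇒row n A pos i | p , Apj , _ ← perm-pos⇒col n A pos j
  = p , q , (λ { refl → true≢false Apj A≡false }) , (λ { refl → true≢false Aiq A≡false }) , Aiq , Apj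

-- Suppose (i , j), (i′ , j) and (i , j′) are ones but (i′ , j′) is not. A nonzero permanent of minor A i j
-- gives further ones (i′ , q) and (p , j′), and then one of the minors at (p , q), (i , j′), (i′ , q)
-- is not rectangular.
Rectangular-from-minors : ∀ n (A : Mat (suc n)) →
  (∀ i j → A i j ≡ true → 0 < perm n (minor A i j) × Rectangular (minor A i j)) → Rectangular A
Rectangular-from-minors zero A h {zero} {zero} {zero} {zero} a b c = a
Rectangular-from-minors (suc n) A h {i} {i′} {j} {j′} a b c with A i′ j′ in d
... | true = refl
... | false = impossible
  where
  i≢i′ : i ≢ i′
  i≢i′ refl = true≢false c d
  j≢j′ : j ≢ j′
  j≢j′ refl = true≢false b d
  around : ∃₂ λ p₀ q₀ → p₀ ≢ punchOut i≢i′ × q₀ ≢ punchOut j≢j′ ×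
    minor A i j (punchOut i≢i′) q₀ ≡ true × minor A i j p₀ (punchOut j≢j′) ≡ true
  around = perm-pos⇒ones-around-zero n (minor A i j) (proj₁ (h i j a))
    (trans (cong₂ A (punchIn-punchOut i≢i′) (punchIn-punchOut j≢j′)) d)
  p₀ = proj₁ around
  q₀ = proj₁ (proj₂ around)
  p₀≢ = proj₁ (proj₂ (proj₂ around))
  q₀≢ = proj₁ (proj₂ (proj₂ (proj₂ around)))
  e = proj₁ (proj₂ (proj₂ (proj₂ (proj₂ around))))
  f = proj₂ (proj₂ (proj₂ (proj₂ (proj₂ around))))
  p = punchIn i p₀
  q = punchIn j q₀
  p≢i : p ≢ i
  p≢i = punchInᵢ≢i i p₀
  q≢j : q ≢ j
  q≢j = punchInᵢ≢i j q₀
  p≢i′ : p ≢ i′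
  p≢i′ eq = p₀≢ (punchIn-injective i _ _ (trans eq (sym (punchIn-punchOut i≢i′))))
  q≢j′ : q ≢ j′
  q≢j′ eq = q₀≢ (punchIn-injective j _ _ (trans eq (sym (punchIn-punchOut j≢j′))))
  Ai′q : A i′ q ≡ true
  Ai′q = trans (cong (λ k → A k q) (sym (punchIn-punchOut i≢i′))) e
  Apj′ : A p j′ ≡ true
  Apj′ = trans (cong (A p) (sym (punchIn-punchOut j≢j′))) f
  impossible : false ≡ true
  -- The three ones and a zero lie in rows i, i′ and columns j, j′ if (p , q) is a one; in rows i′,
  -- p and columns j, q if only (p , j) is; in rows i, p and columns j′, j if neither is. The
  -- deleted row and column avoid them in each case.
  impossible with A p q in x | A p j in y
  ... | true | _ = trans (sym d) (Rectangular-off A p q (proj₂ (h p q x)) p≢i p≢i′ q≢j q≢j′ a b c)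
  ... | false | true = trans (sym x) (Rectangular-off A i j′ (proj₂ (h i j′ c)) i≢i′ (p≢i ∘ sym) (j≢j′ ∘ sym)
      (q≢j′ ∘ sym) b y Ai′q)
  ... | false | false = trans (sym y) (Rectangular-off A i′ q (proj₂ (h i′ q Ai′q)) (i≢i′ ∘ sym) (p≢i′ ∘ sym)
      q≢j′ q≢j c Apj′ a)

module Brègman (L N : ℕ) (L-pos : 0 < L) (w : ℕ → ℕ) (w-pos : ∀ r → 0 < w r)
               (w-root : ∀ r → r ≤ N → w r ^ r ≡ (r !) ^ L) where

  -- The recursion (r + 1)! = (r + 1) · r! in terms of `w`, in the shape in which `h-row` meets it.
  w-pred : ∀ r → suc r ≤ N → suc r ^ L * w r ^ suc r ≡ w (suc r) ^ suc r * w r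
  w-pred r r<N = begin
    suc r ^ L * (w r * w r ^ r)      ≡⟨ cong (λ z → suc r ^ L * (w r * z)) (w-root r (<⇒≤ r<N)) ⟩
    suc r ^ L * (w r * (r !) ^ L)    ≡⟨ e (suc r ^ L) (w r) ((r !) ^ L) ⟩
    suc r ^ L * (r !) ^ L * w r      ≡⟨ cong (_* w r) (^-distribʳ-* L (suc r) (r !)) ⟨
    (suc r !) ^ L * w r              ≡⟨ cong (_* w r) (w-root (suc r) r<N) ⟨
    w (suc r) ^ suc r * w r          ∎
    where
    open ≡-Reasoning
    e : ∀ a b c → a * (b * c) ≡ a * c * b
    e = solve-∀

  -- The chain `X i ≤ Z i ≤ Y i` holds row by row: the entropy bound for row `i` of the cofactors,
  -- then `r i` for the number `s i` of nonzero cofactors and the inductive bound for each minor.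
  -- Only the products over all `i` have a closed form.
  module Step (n : ℕ) (n<N : suc n ≤ N) (A : Mat (suc n)) (P-pos : 0 < perm (suc n) A)
              (minor-bound : ∀ i k → perm n (minor A i k) ^ L ≤
                prodFin n (λ l → w (rowSum n (minor A i k) l))) where
    n′ = suc n
    P = perm n′ A
    p = cofactor A
    r s W X Y Z G : Fin n′ → ℕ
    h D : Fin n′ → Fin n′ → ℕ
    r = rowSum n′ A
    s i = sumFin n′ (sg ∘ p i)
    h j k = w (r j ∸ b2n (A j k))
    D i k = prodFin n (λ l → h (punchIn i l) k)
    W i = w (r i)
    X i = (P ^ P) ^ L
    Z i = (s i ^ P) ^ L * prodFin n′ (λ k → (p i k ^ L) ^ p i k)
    Y i = (r i ^ P) ^ L * prodFin n′ (λ k → D i k ^ p i k)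
    G j = w (r j ∸ 1) ^ P

    r-pos : ∀ i → 0 < r i
    r-pos = perm-pos⇒rowSum-pos n A P-pos

    D-rowSum : ∀ i k → D i k ≡ prodFin n (λ l → w (rowSum n (minor A i k) l))
    D-rowSum i k = prod-cong n λ l → cong w (rowSum-minor n A i k l)

    X≤Z : ∀ i → X i ≤ Z i
    X≤Z i = begin
      (P ^ P) ^ L
        ≤⟨ ^-monoˡ-≤ L (subst (λ T → T ^ T ≤ s i ^ T * prodFin n′ (λ k → p i k ^ p i k))
            (sym (perm-row n A i)) (entropy-bound n′ (p i))) ⟩
      (s i ^ P * prodFin n′ (λ k → p i k ^ p i k)) ^ L
        ≡⟨ ^-distribʳ-* L (s i ^ P) _ ⟩
      (s i ^ P) ^ L * prodFin n′ (λ k → p i k ^ p i k) ^ L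
        ≡⟨ cong ((s i ^ P) ^ L *_) (prod-^ n′ L (λ k → p i k ^ p i k)) ⟨
      (s i ^ P) ^ L * prodFin n′ (λ k → (p i k ^ p i k) ^ L)
        ≡⟨ cong ((s i ^ P) ^ L *_) (prod-cong n′ λ k → ^-swap (p i k) (p i k) L) ⟩
      Z i ∎
      where open ≤-Reasoning

    sg-p≤a : ∀ i k → sg (p i k) ≤ b2n (A i k)
    sg-p≤a i k with A i k
    ... | false = z≤n
    ... | true with perm n (minor A i k) + 0
    ...   | zero = z≤n
    ...   | suc _ = ≤-refl

    s≤r : ∀ i → s i ≤ r i
    s≤r i = sum-mono-≤ n′ (sg-p≤a i)

    p-bound : ∀ i k → (p i k ^ L) ^ p i k ≤ D i k ^ p i k
    p-bound i k with A i k
    ... | false = ≤-refl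
    ... | true = ^-monoˡ-≤ (1 * M) (begin
      (1 * M) ^ L  ≡⟨ cong (_^ L) (*-identityˡ M) ⟩
      M ^ L        ≤⟨ minor-bound i k ⟩
      prodFin n (λ l → w (rowSum n (minor A i k) l)) ≡⟨ D-rowSum i k ⟨
      D i k        ∎)
      where
      open ≤-Reasoning
      M = perm n (minor A i k)

    sP≤rP : ∀ i → (s i ^ P) ^ L ≤ (r i ^ P) ^ L
    sP≤rP i = ^-monoˡ-≤ L (^-monoˡ-≤ P (s≤r i))

    Z≤Y : ∀ i → Z i ≤ Y i
    Z≤Y i = *-mono-≤ (sP≤rP i) (prod-mono-≤ n′ (p-bound i))

    -- Where `A j k` is zero the exponent vanishes, and elsewhere `h j k` is `w (r j ∸ 1)`. So `G j`
    -- is the known factor by which the products `D j k`, which omit row `j`, are completed to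
    -- products over all rows.
    G-prod : ∀ j → prodFin n′ (λ k → h j k ^ p j k) ≡ G j
    G-prod j = begin
      prodFin n′ (λ k → h j k ^ p j k)        ≡⟨ prod-cong n′ entry ⟩
      prodFin n′ (λ k → w (r j ∸ 1) ^ p j k)  ≡⟨ ^-sum n′ (w (r j ∸ 1)) (p j) ⟩
      w (r j ∸ 1) ^ sumFin n′ (p j)           ≡⟨ cong (w (r j ∸ 1) ^_) (perm-row n A j) ⟨
      G j ∎
      where
      open ≡-Reasoning
      entry : ∀ k → h j k ^ p j k ≡ w (r j ∸ 1) ^ p j k
      entry k with A j k
      ... | true = refl
      ... | false = refl

    -- The row j of h contains r j entries w (r j - 1) and n′ - r j entries w (r j).
    h-row : ∀ j → r j ^ L * prodFin n′ (h j) ≡ w (r j ∸ 1) * W j ^ n′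
    h-row j = *-cancelʳ-≡ _ _ (W j ^ r j) {{>-nonZero (^-pos (r j) (w-pos (r j)))}} (begin
      r j ^ L * prodFin n′ (h j) * W j ^ r j
        ≡⟨ *-assoc (r j ^ L) _ _ ⟩
      r j ^ L * (prodFin n′ (h j) * W j ^ r j)
        ≡⟨ cong (λ z → r j ^ L * (prodFin n′ (h j) * z)) (^-sum n′ (W j) (λ k → b2n (A j k))) ⟨
      r j ^ L * (prodFin n′ (h j) * prodFin n′ (λ k → W j ^ b2n (A j k)))
        ≡⟨ cong (r j ^ L *_) (prod-* n′ (h j) (λ k → W j ^ b2n (A j k))) ⟨
      r j ^ L * prodFin n′ (λ k → h j k * W j ^ b2n (A j k))
        ≡⟨ cong (r j ^ L *_) (prod-cong n′ entry) ⟩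
      r j ^ L * prodFin n′ (λ k → w (r j ∸ 1) ^ b2n (A j k) * W j)
        ≡⟨ cong (r j ^ L *_) (prod-* n′ (λ k → w (r j ∸ 1) ^ b2n (A j k)) (λ _ → W j)) ⟩
      r j ^ L * (prodFin n′ (λ k → w (r j ∸ 1) ^ b2n (A j k)) * prodFin n′ (λ _ → W j))
        ≡⟨ cong (r j ^ L *_) (cong₂ _*_ (^-sum n′ (w (r j ∸ 1)) (λ k → b2n (A j k))) (prod-const n′ (W j))) ⟩
      r j ^ L * (w (r j ∸ 1) ^ r j * W j ^ n′)
        ≡⟨ *-assoc (r j ^ L) _ _ ⟨
      r j ^ L * w (r j ∸ 1) ^ r j * W j ^ n′
        ≡⟨ cong (_* W j ^ n′) (pred-form (r j) (r-pos j) (≤-trans (rowSum≤n n′ A j) n<N)) ⟩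
      W j ^ r j * w (r j ∸ 1) * W j ^ n′
        ≡⟨ shuffle (W j ^ r j) (w (r j ∸ 1)) (W j ^ n′) ⟩
      w (r j ∸ 1) * W j ^ n′ * W j ^ r j ∎)
      where
      open ≡-Reasoning
      entry : ∀ k → h j k * W j ^ b2n (A j k) ≡ w (r j ∸ 1) ^ b2n (A j k) * W j
      entry k with A j k
      ... | true = sym (trans (cong (_* W j) (*-identityʳ (w (r j ∸ 1)))) (cong (w (r j ∸ 1) *_)
          (sym (*-identityʳ (W j)))))
      ... | false = *-comm (W j) 1
      pred-form : ∀ q → 0 < q → q ≤ N → q ^ L * w (q ∸ 1) ^ q ≡ w q ^ q * w (q ∸ 1)
      pred-form (suc q) _ q≤N = w-pred q q≤N
      shuffle : ∀ a b c → a * b * c ≡ b * c * a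
      shuffle = solve-∀

    prod-Y : prodFin n′ Y ≡ (prodFin n′ W ^ n′) ^ P
    prod-Y = *-cancelʳ-≡ _ _ (prodFin n′ G) {{>-nonZero (prod-pos n′ λ j → ^-pos P (w-pos (r j ∸ 1)))}} (begin
      -- Multiplication by `G` turns each `D i k` into `H k`, which no longer depends on `i`. The
      -- exponents of `H k` then add up to a column sum of cofactors, which is `P`; regrouped by
      -- rows, `h-row` evaluates the product, and `G` reappears and cancels.
      prodFin n′ Y * prodFin n′ G
        ≡⟨ prod-* n′ Y G ⟨
      prodFin n′ (λ i → Y i * G i)
        ≡⟨ prod-cong n′ collect ⟩
      prodFin n′ (λ i → (r i ^ P) ^ L * prodFin n′ (λ k → H k ^ p i k))
        ≡⟨ prod-* n′ (λ i → (r i ^ P) ^ L) (λ i → prodFin n′ (λ k → H k ^ p i k)) ⟩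
      prodFin n′ (λ i → (r i ^ P) ^ L) * prodFin n′ (λ i → prodFin n′ (λ k → H k ^ p i k))
        ≡⟨ cong (prodFin n′ (λ i → (r i ^ P) ^ L) *_) (begin
          prodFin n′ (λ i → prodFin n′ (λ k → H k ^ p i k))  ≡⟨ prod-swap n′ n′ (λ i k → H k ^ p i k) ⟩
          prodFin n′ (λ k → prodFin n′ (λ i → H k ^ p i k))
            ≡⟨ prod-cong n′ (λ k → trans (^-sum n′ (H k) (λ i → p i k)) (cong (H k ^_)
              (sym (perm-col n A k)))) ⟩
          prodFin n′ (λ k → H k ^ P)                         ≡⟨ prod-^ n′ P H ⟩
          prodFin n′ H ^ P                                   ≡⟨ cong (_^ P) (prod-swap n′ n′ (λ k j → h j k)) ⟩
          prodFin n′ (λ j → prodFin n′ (h j)) ^ P            ≡⟨ prod-^ n′ P (λ j → prodFin n′ (h j)) ⟨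
          prodFin n′ (λ j → prodFin n′ (h j) ^ P)            ∎) ⟩
      prodFin n′ (λ i → (r i ^ P) ^ L) * prodFin n′ (λ j → prodFin n′ (h j) ^ P)
        ≡⟨ prod-* n′ (λ j → (r j ^ P) ^ L) (λ j → prodFin n′ (h j) ^ P) ⟨
      prodFin n′ (λ j → (r j ^ P) ^ L * prodFin n′ (h j) ^ P)
        ≡⟨ prod-cong n′ row ⟩
      prodFin n′ (λ j → (W j ^ n′) ^ P * G j)
        ≡⟨ prod-* n′ (λ j → (W j ^ n′) ^ P) G ⟩
      prodFin n′ (λ j → (W j ^ n′) ^ P) * prodFin n′ G
        ≡⟨ cong (_* prodFin n′ G) (trans (prod-^ n′ P (λ j → W j ^ n′)) (cong (_^ P) (prod-^ n′ n′ W))) ⟩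
      (prodFin n′ W ^ n′) ^ P * prodFin n′ G ∎)
      where
      open ≡-Reasoning
      H : Fin n′ → ℕ
      H k = prodFin n′ (λ j → h j k)
      collect : ∀ i → Y i * G i ≡ (r i ^ P) ^ L * prodFin n′ (λ k → H k ^ p i k)
      collect i = begin
        Y i * G i
          ≡⟨ cong (Y i *_) (G-prod i) ⟨
        (r i ^ P) ^ L * prodFin n′ (λ k → D i k ^ p i k) * prodFin n′ (λ k → h i k ^ p i k)
          ≡⟨ *-assoc ((r i ^ P) ^ L) _ _ ⟩
        (r i ^ P) ^ L * (prodFin n′ (λ k → D i k ^ p i k) * prodFin n′ (λ k → h i k ^ p i k))
          ≡⟨ cong ((r i ^ P) ^ L *_) (prod-* n′ (λ k → D i k ^ p i k) (λ k → h i k ^ p i k)) ⟨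
        (r i ^ P) ^ L * prodFin n′ (λ k → D i k ^ p i k * h i k ^ p i k)
          ≡⟨ cong ((r i ^ P) ^ L *_) (prod-cong n′ λ k → trans (sym (^-distribʳ-* (p i k) (D i k) (h i k)))
               (cong (_^ p i k) (trans (*-comm (D i k) (h i k)) (sym (prod-punchIn n i (λ j → h j k)))))) ⟩
        (r i ^ P) ^ L * prodFin n′ (λ k → H k ^ p i k) ∎
      row : ∀ j → (r j ^ P) ^ L * prodFin n′ (h j) ^ P ≡ (W j ^ n′) ^ P * G j
      row j = begin
        (r j ^ P) ^ L * prodFin n′ (h j) ^ P  ≡⟨ cong (_* prodFin n′ (h j) ^ P) (^-swap (r j) P L) ⟩
        (r j ^ L) ^ P * prodFin n′ (h j) ^ P  ≡⟨ ^-distribʳ-* P (r j ^ L) _ ⟨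
        (r j ^ L * prodFin n′ (h j)) ^ P      ≡⟨ cong (_^ P) (h-row j) ⟩
        (w (r j ∸ 1) * W j ^ n′) ^ P          ≡⟨ ^-distribʳ-* P (w (r j ∸ 1)) _ ⟩
        G j * (W j ^ n′) ^ P                  ≡⟨ *-comm (G j) _ ⟩
        (W j ^ n′) ^ P * G j                  ∎

    prod-X : prodFin n′ X ≡ ((P ^ L) ^ n′) ^ P
    prod-X = trans (prod-const n′ ((P ^ P) ^ L)) (trans (cong (_^ n′) (^-swap P P L)) (^-swap (P ^ L) P n′))

    bound : P ^ L ≤ prodFin n′ W
    bound = ^-cancel-≤ n′ (s≤s z≤n) (^-cancel-≤ P P-pos
      (subst₂ _≤_ prod-X prod-Y (prod-mono-≤ n′ λ i → ≤-trans (X≤Z i) (Z≤Y i))))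

    module Equality (W≤P : prodFin n′ W ≤ P ^ L) where
      X-pos : ∀ i → 0 < X i
      X-pos i = ^-pos L (^-pos P P-pos)

      -- The products of the `X i` and the `Y i` now agree, so the positive factors agree; `Z i`,
      -- lying between them, equals both.
      Y≤Z : ∀ i → Y i ≤ Z i
      Y≤Z i = ≤-trans (prod-≤-reflect n′ {X} {Y} (λ i → ≤-trans (X≤Z i) (Z≤Y i)) X-pos
        (subst₂ _≤_ (sym prod-Y) (sym prod-X) (^-monoˡ-≤ P (^-monoˡ-≤ n′ W≤P))) i) (X≤Z i)

      pp-pos : ∀ i k → 0 < (p i k ^ L) ^ p i k
      pp-pos i k = subst (0 <_) (^-swap (p i k) (p i k) L) (^-pos L (n^n>0 (p i k)))

      sP-pos : ∀ i → 0 < (s i ^ P) ^ L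
      sP-pos i = n≢0⇒n>0 λ e → n>0⇒n≢0 (<-≤-trans (X-pos i) (X≤Z i)) (cong (_* prodFin n′ (λ k → (p i k ^ L) ^
          p i k)) e)

      factors : ∀ i → (r i ^ P) ^ L ≤ (s i ^ P) ^ L ×
        prodFin n′ (λ k → D i k ^ p i k) ≤ prodFin n′ (λ k → (p i k ^ L) ^ p i k)
      factors i = *-≤-reflect (sP≤rP i) (prod-mono-≤ n′ (p-bound i)) (sP-pos i) (prod-pos n′ (pp-pos i)) (Y≤Z i)

      -- Row `i` has as many nonzero cofactors as ones, hence none of its ones has cofactor 0.
      sg-p : ∀ i k → b2n (A i k) ≤ sg (p i k)
      sg-p i = sum-≤-reflect n′ (sg-p≤a i) (^-cancel-≤ P P-pos (^-cancel-≤ L L-pos (proj₁ (factors i))))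

      mp≤pp : ∀ i k → D i k ^ p i k ≤ (p i k ^ L) ^ p i k
      mp≤pp i = prod-≤-reflect n′ (p-bound i) (pp-pos i) (proj₂ (factors i))

      minors-extremal : ∀ i k → A i k ≡ true → 0 < perm n (minor A i k) ×
        prodFin n (λ l → w (rowSum n (minor A i k) l)) ≤ perm n (minor A i k) ^ L
      minors-extremal i k e = subst (0 <_) p≡M p>0 ,
        subst₂ _≤_ (D-rowSum i k) (cong (_^ L) p≡M) (^-cancel-≤ (p i k) p>0 (mp≤pp i k))
        where
        p≡M : p i k ≡ perm n (minor A i k)
        p≡M = trans (cong (λ b → b2n b * perm n (minor A i k)) e) (*-identityˡ _)
        sg-pos : ∀ x → 1 ≤ sg x → 0 < x
        sg-pos (suc x) _ = s≤s z≤n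
        p>0 : 0 < p i k
        p>0 = sg-pos (p i k) (subst (λ b → b2n b ≤ sg (p i k)) e (sg-p i k))

  brègman : ∀ n → n ≤ N → (A : Mat n) → perm n A ^ L ≤ prodFin n (λ i → w (rowSum n A i))
  brègman zero _ A = ≤-reflexive (^-zeroˡ L)
  brègman (suc n) n<N A with n≡0∨n>0 (perm (suc n) A)
  ... | inj₁ P≡0 = ≤-trans (≤-reflexive (trans (cong (_^ L) P≡0) (0^pos L L-pos))) z≤n
    where
    0^pos : ∀ e → 0 < e → 0 ^ e ≡ 0
    0^pos (suc e) _ = refl
  ... | inj₂ P>0 = Step.bound n n<N A P>0 (λ i k → brègman n (<⇒≤ n<N) (minor A i k))

  brègman-minors : ∀ n → suc n ≤ N → (A : Mat (suc n)) → 0 < perm (suc n) A →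
    prodFin (suc n) (λ i → w (rowSum (suc n) A i)) ≤ perm (suc n) A ^ L →
    ∀ i k → A i k ≡ true → 0 < perm n (minor A i k) ×
      prodFin n (λ l → w (rowSum n (minor A i k) l)) ≤ perm n (minor A i k) ^ L
  brègman-minors n n<N A pos = Step.Equality.minors-extremal n n<N A pos
    λ i k → brègman n (<⇒≤ n<N) (minor A i k)

  brègman-equality : ∀ n → n ≤ N → (A : Mat n) → 0 < perm n A →
    prodFin n (λ i → w (rowSum n A i)) ≤ perm n A ^ L → Rectangular A
  brègman-equality zero _ A pos le {()}
  brègman-equality (suc n) n<N A pos le = Rectangular-from-minors n A λ i j e →
    let pos′ , le′ = brègman-minors n n<N A pos le i j e
    in pos′ , brègman-equality n (<⇒≤ n<N) (minor A i j) pos′ le′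

-- Concavity of log (r !) / r

[1+r][3+r]<[2+r]² : ∀ r → (1 + r) * (3 + r) < (2 + r) * (2 + r)
[1+r][3+r]<[2+r]² r = ≤-reflexive (e r)
  where
  e : ∀ r → suc ((1 + r) * (3 + r)) ≡ (2 + r) * (2 + r)
  e = solve-∀

-- Strict concavity of log (r !) / r at r + 1, after clearing denominators and cancelling r !.
FactorialBound : ℕ → (ℕ → ℕ → Set) → Set
FactorialBound r _∼_ = ((r !) ^ 2 * (2 + r) ^ (r * (1 + r))) ∼ ((1 + r) ^ (r * (3 + r)))

-- Multiplied by `(1 + r) ^ (r * (3 + r))`, the left-hand side has 1 + r and 3 + r to the same
-- power, so `[1+r][3+r]<[2+r]²` applies. It makes the step strict, although the induction starts
-- from an equality at 0.
factorial-bound-step : ∀ r → FactorialBound r _≤_ → FactorialBound (suc r) _<_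
factorial-bound-step r h = *-cancelʳ-< (b ^ (r * (3 + r))) _ _ (begin-strict
  ((suc r !) ^ 2 * d ^ E) * b ^ (r * (3 + r))
    ≡⟨ cong (λ z → z * d ^ E * b ^ (r * (3 + r))) (^-distribʳ-* 2 b (r !)) ⟩
  (b ^ 2 * f * d ^ E) * b ^ (r * (3 + r))            ≡⟨ e₁ (b ^ 2) f (d ^ E) (b ^ (r * (3 + r))) ⟩
  f * (b ^ 2 * b ^ (r * (3 + r)) * d ^ E)
    ≡⟨ cong (λ z → f * (z * d ^ E)) (trans (sym (^-distribˡ-+-* b 2 (r * (3 + r)))) (cong (b ^_) (x₁ r))) ⟩
  f * (b ^ E * d ^ E)                                ≡⟨ cong (f *_) (^-distribʳ-* E b d) ⟨
  f * (b * d) ^ E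
    <⟨ *-monoʳ-< f {{>-nonZero (^-pos 2 (1≤n! r))}} (^-monoˡ-< E ([1+r][3+r]<[2+r]² r)) ⟩
  f * (c * c) ^ E
    ≡⟨ cong (f *_) (trans (^-distribʳ-* E c c) (trans (sym (^-distribˡ-+-* c E E)) (trans (cong (c ^_) (x₂ r))
      (^-distribˡ-+-* c (r * (1 + r)) (suc r * (4 + r)))))) ⟩
  f * (c ^ (r * (1 + r)) * c ^ (suc r * (4 + r)))    ≡⟨ *-assoc f _ _ ⟨
  f * c ^ (r * (1 + r)) * c ^ (suc r * (4 + r))      ≤⟨ *-monoˡ-≤ _ h ⟩
  b ^ (r * (3 + r)) * c ^ (suc r * (4 + r))          ≡⟨ *-comm (b ^ (r * (3 + r))) _ ⟩
  c ^ (suc r * (4 + r)) * b ^ (r * (3 + r))          ∎)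
  where
  open ≤-Reasoning
  b = 1 + r
  c = 2 + r
  d = 3 + r
  f = (r !) ^ 2
  E = suc r * (2 + r)
  e₁ : ∀ w x y z → (w * x * y) * z ≡ x * (w * z * y)
  e₁ = solve-∀
  x₁ : ∀ r → 2 + r * (3 + r) ≡ suc r * (2 + r)
  x₁ = solve-∀
  x₂ : ∀ r → suc r * (2 + r) + suc r * (2 + r) ≡ r * (1 + r) + suc r * (4 + r)
  x₂ = solve-∀

factorial-bound-≤ : ∀ r → FactorialBound r _≤_
factorial-bound-≤ zero = ≤-refl
factorial-bound-≤ (suc r) = <⇒≤ (factorial-bound-step r (factorial-bound-≤ r))

factorial-bound : ∀ r → 1 ≤ r → FactorialBound r _<_
factorial-bound (suc r) _ = factorial-bound-step r (factorial-bound-≤ r)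

module Concavity (L N : ℕ) (L-pos : 0 < L) (w : ℕ → ℕ) (w-pos : ∀ r → 0 < w r)
                 (w-root : ∀ r → r ≤ N → w r ^ r ≡ (r !) ^ L) where

  w-power : ∀ r q → r ≤ N → w r ^ (r * q) ≡ ((r !) ^ q) ^ L
  w-power r q r≤N = begin
    w r ^ (r * q)    ≡⟨ ^-*-assoc (w r) r q ⟨
    (w r ^ r) ^ q    ≡⟨ cong (_^ q) (w-root r r≤N) ⟩
    ((r !) ^ L) ^ q  ≡⟨ ^-swap (r !) L q ⟩
    ((r !) ^ q) ^ L  ∎
    where open ≡-Reasoning

  -- The exponent r (r + 1) (r + 2) turns all three roots into powers of factorials. Writing these
  -- through `r !` leaves `factorial-bound`. The case r = 0 is excluded since `w-root` leaves `w 0`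
  -- undetermined.
  w-log-concave : ∀ r → 1 ≤ r → 2 + r ≤ N → w r * w (2 + r) < w (1 + r) * w (1 + r)
  w-log-concave r r≥1 r≤N = ^-cancel-< (r * (b * c)) (begin-strict
    (w r * w c) ^ (r * (b * c))
      ≡⟨ ^-distribʳ-* (r * (b * c)) (w r) (w c) ⟩
    w r ^ (r * (b * c)) * w c ^ (r * (b * c))
      ≡⟨ cong₂ _*_ (w-power r (b * c) (≤-trans (m≤n+m r 2) r≤N)) (trans (cong (w c ^_) (x₁ r b c))
          (w-power c (r * b) r≤N)) ⟩
    (x ^ (b * c)) ^ L * ((c * (b * x)) ^ (r * b)) ^ L
      ≡⟨ ^-distribʳ-* L (x ^ (b * c)) _ ⟨
    (x ^ (b * c) * (c * (b * x)) ^ (r * b)) ^ L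
      <⟨ ^-monoˡ-< L {{>-nonZero L-pos}} core ⟩
    ((b * x) ^ (r * c) * (b * x) ^ (r * c)) ^ L
      ≡⟨ ^-distribʳ-* L ((b * x) ^ (r * c)) _ ⟩
    ((b * x) ^ (r * c)) ^ L * ((b * x) ^ (r * c)) ^ L
      ≡⟨ cong (λ z → z * z) (trans (cong (w b ^_) (x₂ r b c)) (w-power b (r * c) (≤-trans (n≤1+n b) r≤N))) ⟨
    w b ^ (r * (b * c)) * w b ^ (r * (b * c))
      ≡⟨ ^-distribʳ-* (r * (b * c)) (w b) (w b) ⟨
    (w b * w b) ^ (r * (b * c)) ∎)
    where
    open ≤-Reasoning
    b = 1 + r
    c = 2 + r
    x = r !
    x₁ : ∀ r b c → r * (b * c) ≡ c * (r * b)
    x₁ = solve-∀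
    x₂ : ∀ r b c → r * (b * c) ≡ b * (r * c)
    x₂ = solve-∀
    x₃ : ∀ r → (1 + r) * (2 + r) + r * (1 + r) ≡ 2 + (r * (2 + r) + r * (2 + r))
    x₃ = solve-∀
    x₄ : ∀ r → r * (1 + r) + r * (3 + r) ≡ r * (2 + r) + r * (2 + r)
    x₄ = solve-∀
    e₁ : ∀ p q y z → p * (y * (z * q)) ≡ z * (p * q) * y
    e₁ = solve-∀
    K = r * c + r * c
    core : x ^ (b * c) * (c * (b * x)) ^ (r * b) < (b * x) ^ (r * c) * (b * x) ^ (r * c)
    core = begin-strict
      x ^ (b * c) * (c * (b * x)) ^ (r * b)
        ≡⟨ cong (x ^ (b * c) *_) (trans (^-distribʳ-* (r * b) c (b * x)) (cong (c ^ (r * b) *_) (^-distribʳ-*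
            (r * b) b x))) ⟩
      x ^ (b * c) * (c ^ (r * b) * (b ^ (r * b) * x ^ (r * b)))
        ≡⟨ e₁ (x ^ (b * c)) (x ^ (r * b)) (c ^ (r * b)) (b ^ (r * b)) ⟩
      b ^ (r * b) * (x ^ (b * c) * x ^ (r * b)) * c ^ (r * b)
        ≡⟨ cong (λ z → b ^ (r * b) * z * c ^ (r * b)) (trans (sym (^-distribˡ-+-* x (b * c) (r * b)))
            (trans (cong (x ^_) (x₃ r)) (^-distribˡ-+-* x 2 K))) ⟩
      b ^ (r * b) * (x ^ 2 * x ^ K) * c ^ (r * b)
        ≡⟨ shuffle (b ^ (r * b)) (x ^ 2) (x ^ K) (c ^ (r * b)) ⟩
      b ^ (r * b) * x ^ K * (x ^ 2 * c ^ (r * b))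
        <⟨ *-monoʳ-< (b ^ (r * b) * x ^ K) {{>-nonZero (*-mono-≤ (^-pos (r * b) (s≤s z≤n))
            (^-pos K (1≤n! r)))}} (factorial-bound r r≥1) ⟩
      b ^ (r * b) * x ^ K * b ^ (r * (3 + r))
        ≡⟨ shuffle′ (b ^ (r * b)) (x ^ K) (b ^ (r * (3 + r))) ⟩
      b ^ (r * b) * b ^ (r * (3 + r)) * x ^ K
        ≡⟨ cong (_* x ^ K) (trans (sym (^-distribˡ-+-* b (r * b) (r * (3 + r)))) (cong (b ^_) (x₄ r))) ⟩
      b ^ K * x ^ K
        ≡⟨ ^-distribʳ-* K b x ⟨
      (b * x) ^ K
        ≡⟨ ^-distribˡ-+-* (b * x) (r * c) (r * c) ⟩
      (b * x) ^ (r * c) * (b * x) ^ (r * c) ∎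
      where
      shuffle : ∀ p q y z → p * (q * y) * z ≡ p * y * (q * z)
      shuffle = solve-∀
      shuffle′ : ∀ p q y → p * q * y ≡ p * y * q
      shuffle′ = solve-∀

  -- The quotients w (r + 1) / w r decrease. The strict form at distance d + 1 multiplies one
  -- instance of `w-log-concave` with the weak form at distance d.
  w-ratio : ∀ d i → 1 ≤ i → 1 + (d + i) ≤ N → w i * w (1 + (d + i)) ≤ w (1 + i) * w (d + i)
  w-ratio-strict : ∀ d i → 1 ≤ i → 2 + (d + i) ≤ N → w i * w (2 + (d + i)) < w (1 + i) * w (1 + (d + i))

  w-ratio zero i _ _ = ≤-reflexive (*-comm (w i) (w (1 + i)))
  w-ratio (suc d) i i≥1 le = <⇒≤ (w-ratio-strict d i i≥1 le)

  w-ratio-strict d i i≥1 le = *-cancelʳ-< (y * z) _ _ (begin-strict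
    w i * t * (y * z)          ≡⟨ e (w i) t y z ⟩
    y * t * (w i * z)
      <⟨ *-mono-<-≤ (w-log-concave (d + i) (≤-trans i≥1 (m≤n+m i d)) le) (w-ratio d i i≥1 (<⇒≤ le))
        (*-mono-≤ (w-pos i) (w-pos (1 + (d + i)))) ⟩
    z * z * (w (1 + i) * y)    ≡⟨ e′ z (w (1 + i)) y ⟩
    w (1 + i) * z * (y * z)    ∎)
    where
    open ≤-Reasoning
    y = w (d + i)
    z = w (1 + (d + i))
    t = w (2 + (d + i))
    e : ∀ a t y z → a * t * (y * z) ≡ y * t * (a * z)
    e = solve-∀
    e′ : ∀ z a y → z * z * (a * y) ≡ a * z * (y * z)
    e′ = solve-∀

  module Tangent (k : ℕ) (k≥1 : 1 ≤ k) (k<N : suc k ≤ N) where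
    u = w k
    v = w (suc k)

    -- lhs r ≤ rhs r says that log w lies below the line through its values at k and k + 1.
    lhs rhs : ℕ → ℕ
    lhs r = w r * (u ^ r * v ^ k)
    rhs r = v ^ r * u ^ suc k

    -- From r to r + 1 the line rises by log v - log u. By `w-ratio-strict`, log w rises by less
    -- than this for r > k and by more for r < k, which is the case of `step-down`.
    step-up : ∀ r → lhs r ≤ rhs r → u * w (suc r) < v * w r → lhs (suc r) < rhs (suc r)
    step-up r h lt = begin-strict
      w (suc r) * (u * u ^ r * v ^ k)    ≡⟨ e (w (suc r)) u (u ^ r) (v ^ k) ⟩
      u * w (suc r) * (u ^ r * v ^ k)
        <⟨ *-monoˡ-< (u ^ r * v ^ k) {{>-nonZero (*-mono-≤ (^-pos r (w-pos k)) (^-pos k (w-pos (suc k))))}} lt ⟩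
      v * w r * (u ^ r * v ^ k)          ≡⟨ *-assoc v (w r) _ ⟩
      v * lhs r                          ≤⟨ *-monoʳ-≤ v h ⟩
      v * (v ^ r * u ^ suc k)            ≡⟨ *-assoc v (v ^ r) _ ⟨
      rhs (suc r)                        ∎
      where
      open ≤-Reasoning
      e : ∀ a b c d → a * (b * c * d) ≡ b * a * (c * d)
      e = solve-∀

    step-down : ∀ r → lhs (suc r) ≤ rhs (suc r) → w r * v < w (suc r) * u → lhs r < rhs r
    step-down r h lt = *-cancelˡ-< v _ _ (begin-strict
      v * (w r * (u ^ r * v ^ k))        ≡⟨ e v (w r) (u ^ r * v ^ k) ⟩
      w r * v * (u ^ r * v ^ k)
        <⟨ *-monoˡ-< (u ^ r * v ^ k) {{>-nonZero (*-mono-≤ (^-pos r (w-pos k)) (^-pos k (w-pos (suc k))))}} lt ⟩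
      w (suc r) * u * (u ^ r * v ^ k)    ≡⟨ e′ (w (suc r)) u (u ^ r) (v ^ k) ⟩
      lhs (suc r)                        ≤⟨ h ⟩
      v * v ^ r * u ^ suc k              ≡⟨ *-assoc v (v ^ r) _ ⟩
      v * rhs r                          ∎)
      where
      open ≤-Reasoning
      e : ∀ a b c → a * (b * c) ≡ b * a * c
      e = solve-∀
      e′ : ∀ a b c d → a * b * (c * d) ≡ a * (b * c * d)
      e′ = solve-∀

    at-k : lhs k ≡ rhs k
    at-k = e u (u ^ k) (v ^ k)
      where
      e : ∀ a b c → a * (b * c) ≡ c * (a * b)
      e = solve-∀

    at-suc-k : lhs (suc k) ≡ rhs (suc k)
    at-suc-k = e v (u ^ suc k) (v ^ k)
      where
      e : ∀ a b c → a * (b * c) ≡ a * c * b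
      e = solve-∀

    above : ∀ d → 1 + (d + k) ≤ N → lhs (1 + (d + k)) ≤ rhs (1 + (d + k))
    above-strict : ∀ d → 2 + (d + k) ≤ N → lhs (2 + (d + k)) < rhs (2 + (d + k))
    above zero le = ≤-reflexive at-suc-k
    above (suc d) le = <⇒≤ (above-strict d le)
    above-strict d le = step-up (1 + (d + k)) (above d (<⇒≤ le)) (w-ratio-strict d k k≥1 le)

    below : ∀ d r → 1 ≤ r → d + r ≡ k → lhs r ≤ rhs r
    below-strict : ∀ d r → 1 ≤ r → 1 + (d + r) ≡ k → lhs r < rhs r
    below zero r r≥1 refl = ≤-reflexive at-k
    below (suc d) r r≥1 e = <⇒≤ (below-strict d r r≥1 e)
    below-strict d r r≥1 e = step-down r (below d (suc r) (s≤s z≤n) (trans (+-suc d r) e))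
      (subst (λ j → w r * w (suc j) < w (suc r) * w j) e
        (w-ratio-strict d r r≥1 (subst (λ j → suc j ≤ N) (sym e) k<N)))

    tangent : ∀ r → 1 ≤ r → r ≤ N → (r ≡ k ⊎ r ≡ suc k) × lhs r ≡ rhs r ⊎ lhs r < rhs r
    tangent r r≥1 r≤N with <-cmp r k
    ... | tri≈ _ refl _ = inj₁ (inj₁ refl , at-k)
    ... | tri< r<k _ _ with m≤n⇒∃[o]m+o≡n r<k
    ...   | d , e = inj₂ (below-strict d r r≥1 (trans (cong suc (+-comm d r)) e))
    tangent r r≥1 r≤N | tri> _ _ k<r with m≤n⇒∃[o]m+o≡n k<r
    ...   | zero , e = inj₁ (inj₂ (sym (trans (sym (+-identityʳ (suc k))) e)) , subst (λ r → lhs r ≡ rhs r)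
        (trans (sym (+-identityʳ (suc k))) e) at-suc-k)
    ...   | suc d , refl rewrite +-suc k d | +-comm k d = inj₂ (above-strict d r≤N)

    tangent-≤ : ∀ r → 1 ≤ r → r ≤ N → lhs r ≤ rhs r
    tangent-≤ r r≥1 r≤N with tangent r r≥1 r≤N
    ... | inj₁ (_ , e) = ≤-reflexive e
    ... | inj₂ lt = <⇒≤ lt

    tangent-equality : ∀ r → 1 ≤ r → r ≤ N → rhs r ≤ lhs r → r ≡ k ⊎ r ≡ suc k
    tangent-equality r r≥1 r≤N le with tangent r r≥1 r≤N
    ... | inj₁ (e , _) = e
    ... | inj₂ lt = contradiction le (<⇒≱ lt)

    -- Multiplied over all rows, the tangent inequality involves the individual row sums only
    -- through `w`; elsewhere only their sum σ enters. Cancelling `S` leaves v to the power σ - kn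
    -- and u to the power (k + 1) n - σ. These are multiples of k + 1 and k, so the roots become
    -- factorials.
    module Rows (n a b : ℕ) (r : Fin n → ℕ) (r≥1 : ∀ i → 1 ≤ r i) (r≤N : ∀ i → r i ≤ N)
                (sum-r : sumFin n r ≡ k * n + suc k * a) (kn : suc k * n ≡ sumFin n r + k * b) where
      σ = sumFin n r
      S = u ^ σ * v ^ (k * n)

      S-pos : 0 < S
      S-pos = *-mono-≤ (^-pos σ (w-pos k)) (^-pos (k * n) (w-pos (suc k)))

      prod-lhs : prodFin n (lhs ∘ r) ≡ prodFin n (w ∘ r) * S
      prod-lhs = begin
        prodFin n (lhs ∘ r)                                       ≡⟨ prod-* n (w ∘ r) (λ i → u ^ r i * v ^ k) ⟩
        prodFin n (w ∘ r) * prodFin n (λ i → u ^ r i * v ^ k)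
          ≡⟨ cong (prodFin n (w ∘ r) *_) (prod-* n (λ i → u ^ r i) (λ _ → v ^ k)) ⟩
        prodFin n (w ∘ r) * (prodFin n (λ i → u ^ r i) * prodFin n (λ _ → v ^ k))
          ≡⟨ cong (prodFin n (w ∘ r) *_) (cong₂ _*_ (^-sum n u r) (trans (prod-const n (v ^ k)) (^-*-assoc v k
              n))) ⟩
        prodFin n (w ∘ r) * S                                     ∎
        where open ≡-Reasoning

      prod-rhs : prodFin n (rhs ∘ r) ≡ v ^ (suc k * a) * u ^ (k * b) * S
      prod-rhs = begin
        prodFin n (rhs ∘ r)
          ≡⟨ prod-* n (λ i → v ^ r i) (λ _ → u ^ suc k) ⟩
        prodFin n (λ i → v ^ r i) * prodFin n (λ _ → u ^ suc k)
          ≡⟨ cong₂ _*_ (^-sum n v r) (trans (prod-const n (u ^ suc k)) (^-*-assoc u (suc k) n)) ⟩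
        v ^ σ * u ^ (suc k * n)
          ≡⟨ cong₂ _*_ (trans (cong (v ^_) sum-r) (^-distribˡ-+-* v (k * n) (suc k * a)))
            (trans (cong (u ^_) kn) (^-distribˡ-+-* u σ (k * b))) ⟩
        v ^ (k * n) * v ^ (suc k * a) * (u ^ σ * u ^ (k * b))
          ≡⟨ e (v ^ (k * n)) (v ^ (suc k * a)) (u ^ σ) (u ^ (k * b)) ⟩
        v ^ (suc k * a) * u ^ (k * b) * S                              ∎
        where
        open ≡-Reasoning
        e : ∀ x y z t → x * y * (z * t) ≡ y * t * (z * x)
        e = solve-∀

      pointwise : ∀ i → lhs (r i) ≤ rhs (r i)
      pointwise i = tangent-≤ (r i) (r≥1 i) (r≤N i)

      max≡ : v ^ (suc k * a) * u ^ (k * b) ≡ (((suc k) !) ^ a * (k !) ^ b) ^ L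
      max≡ = trans (cong₂ _*_ (w-power (suc k) a k<N) (w-power k b (<⇒≤ k<N)))
          (sym (^-distribʳ-* L (((suc k) !) ^ a) ((k !) ^ b)))

      prod-w-≤ : prodFin n (w ∘ r) ≤ (((suc k) !) ^ a * (k !) ^ b) ^ L
      prod-w-≤ = subst (prodFin n (w ∘ r) ≤_) max≡ (*-cancelʳ-≤ _ _ S {{>-nonZero S-pos}}
        (subst₂ _≤_ prod-lhs prod-rhs (prod-mono-≤ n pointwise)))

      prod-w-equality : (((suc k) !) ^ a * (k !) ^ b) ^ L ≤ prodFin n (w ∘ r) → ∀ i → r i ≡ k ⊎ r i ≡ suc k
      prod-w-equality le i = tangent-equality (r i) (r≥1 i) (r≤N i)
        (prod-≤-reflect n pointwise
          (λ i → *-mono-≤ (w-pos (r i)) (*-mono-≤ (^-pos (r i) (w-pos k)) (^-pos k (w-pos (suc k)))))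
          (subst₂ _≤_ (sym prod-rhs) (sym prod-lhs) (*-monoˡ-≤ S (subst (_≤ prodFin n (w ∘ r)) (sym max≡)
              le))) i)

-- Direct sums of all-ones matrices

sum-split : ∀ m n (f : Fin (m + n) → ℕ) →
  sumFin (m + n) f ≡ sumFin m (f ∘ (_↑ˡ n)) + sumFin n (f ∘ (m ↑ʳ_))
sum-split zero n f = refl
sum-split (suc m) n f = trans (cong (f zero +_) (sum-split m n (f ∘ suc))) (sym (+-assoc (f zero) _ _))

-- The case distinction of `_⊕_` on explicit sum elements, where it computes; `_⊕_` itself is stuck
-- on `splitAt`.
⊕-entry : Mat m → Mat n → Fin m ⊎ Fin n → Fin m ⊎ Fin n → Bool
⊕-entry A B (inj₁ i) (inj₁ j) = A i j
⊕-entry A B (inj₂ i) (inj₂ j) = B i j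
⊕-entry A B (inj₁ _) (inj₂ _) = false
⊕-entry A B (inj₂ _) (inj₁ _) = false

⊕-splitAt : (A : Mat m) (B : Mat n) → ∀ i j → (A ⊕ B) i j ≡ ⊕-entry A B (splitAt m i) (splitAt m j)
⊕-splitAt {m} A B i j with splitAt m i | splitAt m j
... | inj₁ _ | inj₁ _ = refl
... | inj₂ _ | inj₂ _ = refl
... | inj₁ _ | inj₂ _ = refl
... | inj₂ _ | inj₁ _ = refl

⊕-join : (A : Mat m) (B : Mat n) → ∀ x y → (A ⊕ B) (join m n x) (join m n y) ≡ ⊕-entry A B x y
⊕-join {m} {n} A B x y = trans (⊕-splitAt A B (join m n x) (join m n y))
  (cong₂ (⊕-entry A B) (splitAt-join m n x) (splitAt-join m n y))

splitAt-punchIn : ∀ m n (j : Fin (suc m)) (y : Fin (m + n)) →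
  splitAt (suc m) (punchIn (j ↑ˡ n) y) ≡ Sum.map (punchIn j) id (splitAt m y)
splitAt-punchIn m n zero y = refl
splitAt-punchIn (suc m) n (suc j) zero = refl
splitAt-punchIn (suc m) n (suc j) (suc y) =
  trans (cong (Sum.map suc id) (splitAt-punchIn m n j y)) (maps (splitAt m y))
  where
  maps : ∀ z → Sum.map suc id (Sum.map (punchIn j) id z) ≡ Sum.map (punchIn (suc j)) id (Sum.map suc id z)
  maps (inj₁ _) = refl
  maps (inj₂ _) = refl

minor-J-⊕ : ∀ m n (B : Mat n) j x y → minor (J (suc m) ⊕ B) zero (j ↑ˡ n) x y ≡ (J m ⊕ B) x y
minor-J-⊕ m n B j x y = begin
  (J (suc m) ⊕ B) (suc x) (punchIn (j ↑ˡ n) y)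
    ≡⟨ ⊕-splitAt (J (suc m)) B (suc x) (punchIn (j ↑ˡ n) y) ⟩
  ⊕-entry (J (suc m)) B (Sum.map suc id (splitAt m x)) (splitAt (suc m) (punchIn (j ↑ˡ n) y))
    ≡⟨ cong (⊕-entry (J (suc m)) B (Sum.map suc id (splitAt m x))) (splitAt-punchIn m n j y) ⟩
  ⊕-entry (J (suc m)) B (Sum.map suc id (splitAt m x)) (Sum.map (punchIn j) id (splitAt m y))
    ≡⟨ shrink (splitAt m x) (splitAt m y) ⟩
  ⊕-entry (J m) B (splitAt m x) (splitAt m y)
    ≡⟨ ⊕-splitAt (J m) B x y ⟨
  (J m ⊕ B) x y ∎
  where
  open ≡-Reasoning
  shrink : ∀ s t → ⊕-entry (J (suc m)) B (Sum.map suc id s) (Sum.map (punchIn j) id t) ≡ ⊕-entry (J m) B s t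
  shrink (inj₁ _) (inj₁ _) = refl
  shrink (inj₁ _) (inj₂ _) = refl
  shrink (inj₂ _) (inj₁ _) = refl
  shrink (inj₂ _) (inj₂ _) = refl

-- All `suc m` ones of row zero have the same minor `J m ⊕ B`, so the expansion reproduces the
-- recursion of `fact`.
perm-J-⊕ : ∀ m n (B : Mat n) → perm (m + n) (J m ⊕ B) ≡ fact m * perm n B
perm-J-⊕ zero n B = trans (perm-cong n λ i j → ⊕-splitAt (J 0) B i j) (sym (*-identityˡ _))
perm-J-⊕ (suc m) n B = begin
  sumFin (suc m + n) (cofactor K zero)
    ≡⟨ sum-split (suc m) n (cofactor K zero) ⟩
  sumFin (suc m) (λ j → cofactor K zero (j ↑ˡ n)) + sumFin n (λ j → cofactor K zero (suc m ↑ʳ j))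
    ≡⟨ cong₂ _+_ (sum-cong (suc m) inside) (sum-cong n outside) ⟩
  sumFin (suc m) (λ _ → fact m * perm n B) + sumFin n (λ _ → 0)
    ≡⟨ cong₂ _+_ (sum-const (suc m) _) (trans (sum-const n 0) (*-zeroʳ n)) ⟩
  suc m * (fact m * perm n B) + 0
    ≡⟨ +-identityʳ _ ⟩
  suc m * (fact m * perm n B)
    ≡⟨ *-assoc (suc m) (fact m) _ ⟨
  fact (suc m) * perm n B ∎
  where
  open ≡-Reasoning
  K = J (suc m) ⊕ B
  inside : ∀ j → cofactor K zero (j ↑ˡ n) ≡ fact m * perm n B
  inside j = trans (cong₂ _*_ (cong b2n (⊕-join (J (suc m)) B (inj₁ zero) (inj₁ j)))
      (trans (perm-cong (m + n) (minor-J-⊕ m n B j)) (perm-J-⊕ m n B)))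
    (*-identityˡ _)
  outside : ∀ j → cofactor K zero (suc m ↑ʳ j) ≡ 0
  outside j = cong (λ e → b2n e * perm (m + n) (minor K zero (suc m ↑ʳ j))) (⊕-join (J (suc m)) B (inj₁ zero)
      (inj₂ j))

ones : ∀ n → Mat n → ℕ
ones n A = sumFin n (rowSum n A)

zeros+ones : ∀ n (A : Mat n) → zeros A + ones n A ≡ n * n
zeros+ones n A = begin
  zeros A + ones n A                                                     ≡⟨ sum-+ n _ _ ⟨
  sumFin n (λ i → sumFin n (λ j → b2n (not (A i j))) + rowSum n A i)
    ≡⟨ sum-cong n (λ i → trans (sym (sum-+ n _ _)) (sum-cong n λ j → not-+ (A i j))) ⟩
  sumFin n (λ _ → sumFin n (λ _ → 1))                                    ≡⟨ sum-const n (sumFin n (λ _ → 1)) ⟩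
  n * sumFin n (λ _ → 1)
    ≡⟨ cong (n *_) (trans (sum-const n 1) (*-identityʳ n)) ⟩
  n * n                                                                  ∎
  where
  open ≡-Reasoning
  not-+ : ∀ b → b2n (not b) + b2n b ≡ 1
  not-+ true = refl
  not-+ false = refl

ones-J-⊕ : ∀ m n (B : Mat n) → ones (m + n) (J m ⊕ B) ≡ m * m + ones n B
ones-J-⊕ m n B = begin
  ones (m + n) K
    ≡⟨ sum-split m n (rowSum (m + n) K) ⟩
  sumFin m (λ i → rowSum (m + n) K (i ↑ˡ n)) + sumFin n (λ i → rowSum (m + n) K (m ↑ʳ i))
    ≡⟨ cong₂ _+_ (sum-cong m upper) (sum-cong n lower) ⟩
  sumFin m (λ _ → m) + ones n B
    ≡⟨ cong (_+ ones n B) (sum-const m m) ⟩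
  m * m + ones n B ∎
  where
  open ≡-Reasoning
  K = J m ⊕ B
  entry : ∀ x y → b2n (K (join m n x) (join m n y)) ≡ b2n (⊕-entry (J m) B x y)
  entry x y = cong b2n (⊕-join (J m) B x y)
  upper : ∀ i → rowSum (m + n) K (i ↑ˡ n) ≡ m
  upper i = begin
    rowSum (m + n) K (i ↑ˡ n)                    ≡⟨ sum-split m n _ ⟩
    sumFin m (λ j → b2n (K (i ↑ˡ n) (j ↑ˡ n))) + sumFin n (λ j → b2n (K (i ↑ˡ n) (m ↑ʳ j)))
                                                 ≡⟨ cong₂ _+_ (sum-cong m λ j → entry (inj₁ i) (inj₁ j))
                                                     (sum-cong n λ j → entry (inj₁ i) (inj₂ j)) ⟩
    sumFin m (λ _ → 1) + sumFin n (λ _ → 0)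
      ≡⟨ cong₂ _+_ (trans (sum-const m 1) (*-identityʳ m)) (trans (sum-const n 0) (*-zeroʳ n)) ⟩
    m + 0                                        ≡⟨ +-identityʳ m ⟩
    m                                            ∎
  lower : ∀ i → rowSum (m + n) K (m ↑ʳ i) ≡ rowSum n B i
  lower i = begin
    rowSum (m + n) K (m ↑ʳ i)                    ≡⟨ sum-split m n _ ⟩
    sumFin m (λ j → b2n (K (m ↑ʳ i) (j ↑ˡ n))) + sumFin n (λ j → b2n (K (m ↑ʳ i) (m ↑ʳ j)))
                                                 ≡⟨ cong₂ _+_ (sum-cong m λ j → entry (inj₂ i) (inj₁ j))
                                                     (sum-cong n λ j → entry (inj₂ i) (inj₂ j)) ⟩
    sumFin m (λ _ → 0) + rowSum n B i            ≡⟨ cong (_+ rowSum n B i) (trans (sum-const m 0) (*-zeroʳ m)) ⟩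
    rowSum n B i                                 ∎

pow≡^ : ∀ x e → pow x e ≡ x ^ e
pow≡^ x zero = refl
pow≡^ x (suc e) = cong (x *_) (pow≡^ x e)

fact≡! : ∀ n → fact n ≡ n !
fact≡! zero = refl
fact≡! (suc n) = cong (suc n *_) (fact≡! n)

perm-replicate : ∀ b k ss → perm _ (blockDiag (replicate b k ++ ss)) ≡ pow (fact k) b * perm _ (blockDiag ss)
perm-replicate zero k ss = sym (*-identityˡ _)
perm-replicate (suc b) k ss = trans (perm-J-⊕ k _ (blockDiag (replicate b k ++ ss)))
  (trans (cong (fact k *_) (perm-replicate b k ss)) (sym (*-assoc (fact k) _ _)))

ones-replicate : ∀ b k ss → ones _ (blockDiag (replicate b k ++ ss)) ≡ b * (k * k) + ones _ (blockDiag ss)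
ones-replicate zero k ss = refl
ones-replicate (suc b) k ss = trans (ones-J-⊕ k _ (blockDiag (replicate b k ++ ss)))
  (trans (cong (k * k +_) (ones-replicate b k ss)) (sym (+-assoc (k * k) _ _)))

sum-replicate-++ : ∀ b k ss → sum (replicate b k ++ ss) ≡ b * k + sum ss
sum-replicate-++ zero k ss = refl
sum-replicate-++ (suc b) k ss = trans (cong (k +_) (sum-replicate-++ b k ss)) (sym (+-assoc k _ _))

replicate-++-[] : ∀ b (k : ℕ) → replicate b k ++ [] ≡ replicate b k
replicate-++-[] zero k = refl
replicate-++-[] (suc b) k = cong (k ∷_) (replicate-++-[] b k)

perm-Kmat : ∀ k a b → perm _ (Kmat k a b) ≡ pow (fact (suc k)) a * pow (fact k) b
perm-Kmat k a b = trans (perm-replicate a (suc k) (replicate b k)) (cong (pow (fact (suc k)) a *_)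
  (subst (λ ss → perm _ (blockDiag ss) ≡ pow (fact k) b) (replicate-++-[] b k)
    (trans (perm-replicate b k []) (*-identityʳ _))))

ones-Kmat : ∀ k a b → ones _ (Kmat k a b) ≡ a * (suc k * suc k) + b * (k * k)
ones-Kmat k a b = trans (ones-replicate a (suc k) (replicate b k)) (cong (a * (suc k * suc k) +_)
  (subst (λ ss → ones _ (blockDiag ss) ≡ b * (k * k)) (replicate-++-[] b k)
    (trans (ones-replicate b k []) (+-identityʳ _))))

sum-Ksizes : ∀ k a b → sum (Ksizes k a b) ≡ a * suc k + b * k
sum-Ksizes k a b = trans (sum-replicate-++ a (suc k) (replicate b k)) (cong (a * suc k +_)
  (subst (λ ss → sum ss ≡ b * k) (replicate-++-[] b k) (trans (sum-replicate-++ b k []) (+-identityʳ _))))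

-- Equivalence relations as direct sums

transversal : ∀ n (A : Mat n) → 0 < perm n A → Σ (Permutation n n) λ v → ∀ i → A i (v ⟨$⟩ʳ i) ≡ true
transversal zero A pos = Perm.id , λ ()
transversal (suc n) A pos with perm-pos⇒row n A pos zero
... | k , e , pos′ with transversal n (minor A zero k) pos′
...   | v , h = Perm.insert zero k v , λ
  { zero → e
  ; (suc i) → trans (cong (A (suc i)) (Perm.insert-punchIn zero k v i)) (h i) }

consˡ : ∀ {c d} → Fin n ↔ (Fin c ⊎ Fin d) → Fin (suc n) ↔ (Fin (suc c) ⊎ Fin d)
consˡ {n} {c} {d} π = mk↔ₛ′ to from to∘from from∘to
  where
  module π = Inverse π
  to : Fin (suc n) → Fin (suc c) ⊎ Fin d
  to zero = inj₁ zero
  to (suc i) = Sum.map suc id (π.to i)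
  from : Fin (suc c) ⊎ Fin d → Fin (suc n)
  from (inj₁ zero) = zero
  from (inj₁ (suc x)) = suc (π.from (inj₁ x))
  from (inj₂ y) = suc (π.from (inj₂ y))
  to∘from : ∀ z → to (from z) ≡ z
  to∘from (inj₁ zero) = refl
  to∘from (inj₁ (suc x)) = cong (Sum.map suc id) (π.strictlyInverseˡ (inj₁ x))
  to∘from (inj₂ y) = cong (Sum.map suc id) (π.strictlyInverseˡ (inj₂ y))
  from∘to : ∀ i → from (to i) ≡ i
  from∘to zero = refl
  from∘to (suc i) = trans (shift (π.to i)) (cong suc (π.strictlyInverseʳ i))
    where
    shift : ∀ z → from (Sum.map suc id z) ≡ suc (π.from z)
    shift (inj₁ _) = refl
    shift (inj₂ _) = refl

consʳ : ∀ {c d} → Fin n ↔ (Fin c ⊎ Fin d) → Fin (suc n) ↔ (Fin c ⊎ Fin (suc d))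
consʳ π = swap-↔ ↔-∘ consˡ (swap-↔ ↔-∘ π)

-- For a row `f` of a matrix the size of the left part is its row sum by definition, so `blocks` can
-- use it as a block size without transport.
partition : ∀ n (f : Fin n → Bool) → ∃ λ d → Σ (Fin n ↔ (Fin (sumFin n (b2n ∘ f)) ⊎ Fin d)) λ π →
  (∀ x → f (Inverse.from π (inj₁ x)) ≡ true) × (∀ y → f (Inverse.from π (inj₂ y)) ≡ false)
partition zero f = 0 , mk↔ₛ′ (λ ()) (λ { (inj₁ ()) ; (inj₂ ()) }) (λ { (inj₁ ()) ; (inj₂ ()) }) (λ ()) ,
  (λ ()) , (λ ())
partition (suc n) f with f zero in e | partition n (f ∘ suc)
... | true | d , π , l , r = d , consˡ π , (λ { zero → e ; (suc x) → l x }) , r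
... | false | d , π , l , r = suc d , consʳ π , l , λ { zero → e ; (suc y) → r y }

sum-partition : ∀ n c d (π : Fin n ↔ (Fin c ⊎ Fin d)) f →
  sumFin n f ≡ sumFin c (f ∘ Inverse.from π ∘ inj₁) + sumFin d (f ∘ Inverse.from π ∘ inj₂)
sum-partition n c d π f = begin
  sumFin n f                                 ≡⟨ sum-permute (c + d) n ρ f ⟩
  sumFin (c + d) (f ∘ (ρ ⟨$⟩ʳ_))             ≡⟨ sum-split c d (f ∘ (ρ ⟨$⟩ʳ_)) ⟩
  sumFin c (f ∘ (ρ ⟨$⟩ʳ_) ∘ (_↑ˡ d)) + sumFin d (f ∘ (ρ ⟨$⟩ʳ_) ∘ (c ↑ʳ_))
    ≡⟨ cong₂ _+_ (sum-cong c λ x → cong (f ∘ Inverse.from π) (splitAt-↑ˡ c x d))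
                 (sum-cong d λ y → cong (f ∘ Inverse.from π) (splitAt-↑ʳ c d y)) ⟩
  sumFin c (f ∘ Inverse.from π ∘ inj₁) + sumFin d (f ∘ Inverse.from π ∘ inj₂) ∎
  where
  open ≡-Reasoning
  ρ : Permutation (c + d) n
  ρ = ↔-sym π ↔-∘ +↔⊎

δ : ℕ → ℕ → ℕ
δ s t = b2n ⌊ s ℕₚ.≟ t ⌋

δ-refl : ∀ t → δ t t ≡ 1
δ-refl t with t ℕₚ.≟ t
... | yes _ = refl
... | no t≢t = contradiction refl t≢t

δ-pos : ∀ s t → 0 < δ s t → s ≡ t
δ-pos s t p with s ℕₚ.≟ t
... | yes e = e

*-δ : ∀ s t → s * δ s t ≡ t * δ s t
*-δ s t with s ℕₚ.≟ t
... | yes refl = refl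
... | no _ = trans (*-zeroʳ s) (sym (*-zeroʳ t))

rowsWithSum : ∀ n → Mat n → ℕ → ℕ
rowsWithSum n A t = sumFin n (λ i → δ (rowSum n A i) t)

multiplicity : ℕ → List ℕ → ℕ
multiplicity t [] = 0
multiplicity t (s ∷ ss) = δ s t + multiplicity t ss

Reflexive : Mat n → Set
Reflexive B = ∀ i → B i i ≡ true

≢true⇒false : ∀ {b} → (b ≡ true → false ≡ true) → b ≡ false
≢true⇒false {true} h = sym (h refl)
≢true⇒false {false} h = refl

-- A reflexive rectangular relation is an equivalence relation; split off the class of one index.
module Class (n : ℕ) (B : Mat n) (rfl : Reflexive B) (rect : Rectangular B) (i₀ : Fin n)
             (s d : ℕ) (π : Fin n ↔ (Fin s ⊎ Fin d))
             (inside : ∀ x → B i₀ (Inverse.from π (inj₁ x)) ≡ true)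
             (outside : ∀ y → B i₀ (Inverse.from π (inj₂ y)) ≡ false) where
  φ : Fin s → Fin n
  φ = Inverse.from π ∘ inj₁
  ψ : Fin d → Fin n
  ψ = Inverse.from π ∘ inj₂

  rest : Mat d
  rest y y′ = B (ψ y) (ψ y′)

  entry : ∀ z z′ → B (Inverse.from π z) (Inverse.from π z′) ≡ ⊕-entry (J s) rest z z′
  -- Rows with a common one are equal. By reflexivity row `φ x` shares column `φ x` with row `i₀`;
  -- so would row `ψ y` if it had a one there, but its diagonal one is a zero of row `i₀`.
  entry (inj₁ x) (inj₁ x′) = rect (inside x) (rfl (φ x)) (inside x′)
  entry (inj₁ x) (inj₂ y) = ≢true⇒false λ e → trans (sym (outside y)) (rect (rfl (φ x)) (inside x) e)
  entry (inj₂ y) (inj₁ x) = ≢true⇒false λ e → trans (sym (outside y)) (rect e (inside x) (rfl (ψ y)))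
  entry (inj₂ y) (inj₂ y′) = refl

  rowSum-φ : ∀ x → rowSum n B (φ x) ≡ s
  rowSum-φ x = begin
    rowSum n B (φ x)                        ≡⟨ sum-partition n s d π _ ⟩
    sumFin s (λ x′ → b2n (B (φ x) (φ x′))) + sumFin d (λ y → b2n (B (φ x) (ψ y)))
      ≡⟨ cong₂ _+_ (sum-cong s λ x′ → cong b2n (entry (inj₁ x) (inj₁ x′))) (sum-cong d λ y → cong b2n
          (entry (inj₁ x) (inj₂ y))) ⟩
    sumFin s (λ _ → 1) + sumFin d (λ _ → 0)
      ≡⟨ cong₂ _+_ (trans (sum-const s 1) (*-identityʳ s)) (trans (sum-const d 0) (*-zeroʳ d)) ⟩
    s + 0                                   ≡⟨ +-identityʳ s ⟩
    s                                       ∎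
    where open ≡-Reasoning

  rowSum-ψ : ∀ y → rowSum n B (ψ y) ≡ rowSum d rest y
  rowSum-ψ y = begin
    rowSum n B (ψ y)                        ≡⟨ sum-partition n s d π _ ⟩
    sumFin s (λ x → b2n (B (ψ y) (φ x))) + rowSum d rest y
      ≡⟨ cong (_+ rowSum d rest y) (trans (sum-cong s λ x → cong b2n (entry (inj₂ y) (inj₁ x)))
          (trans (sum-const s 0) (*-zeroʳ s))) ⟩
    rowSum d rest y                         ∎
    where open ≡-Reasoning

  rowsWithSum-rest : ∀ t → rowsWithSum n B t ≡ t * δ s t + rowsWithSum d rest t
  rowsWithSum-rest t = begin
    rowsWithSum n B t                             ≡⟨ sum-partition n s d π _ ⟩
    sumFin s (λ x → δ (rowSum n B (φ x)) t) + sumFin d (λ y → δ (rowSum n B (ψ y)) t)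
      ≡⟨ cong₂ _+_ (sum-cong s λ x → cong (λ r → δ r t) (rowSum-φ x)) (sum-cong d λ y → cong (λ r → δ r t)
          (rowSum-ψ y)) ⟩
    sumFin s (λ _ → δ s t) + rowsWithSum d rest t
      ≡⟨ cong (_+ rowsWithSum d rest t) (trans (sum-const s (δ s t)) (*-δ s t)) ⟩
    t * δ s t + rowsWithSum d rest t              ∎
    where open ≡-Reasoning

-- A class with t elements accounts for t rows of sum t. The count thus provides a row of sum `s`,
-- and removing its class lowers both sides by `t * δ s t`. An entry 0 in the list would provide no
-- such row.
blocks : ∀ ss → All (0 <_) ss → ∀ n (B : Mat n) → Reflexive B → Rectangular B →
  (∀ t → rowsWithSum n B t ≡ t * multiplicity t ss) →
  Σ (Fin n ↔ Fin (sum ss)) λ p → ∀ i j → blockDiag ss (p ⟨$⟩ʳ i) (p ⟨$⟩ʳ j) ≡ B i j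
blocks [] _ zero B rfl rect h = Perm.id , λ ()
blocks [] _ (suc n) B rfl rect h = contradiction (trans (h t) (*-zeroʳ t))
  (n>0⇒n≢0 (≤-trans (≤-reflexive (sym (δ-refl t))) (m≤m+n (δ t t) _)))
  where
  t = rowSum (suc n) B zero
blocks (s ∷ ss) (s>0 ∷ ss>0) n B rfl rect h
  with sum-pos⇒term-pos n (λ i → δ (rowSum n B i) s) (subst (0 <_) (sym (h s))
    (*-mono-≤ s>0 (≤-trans (≤-reflexive (sym (δ-refl s))) (m≤m+n (δ s s) _))))
... | i₀ , q with δ-pos (rowSum n B i₀) s q
...   | refl with partition n (B i₀)
...     | d , π , inside , outside = p , entries
  where
  open Class n B rfl rect i₀ s d π inside outside
  rec = blocks ss ss>0 d rest (rfl ∘ ψ) rect λ t → +-cancelˡ-≡ (t * δ s t) _ _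
    (trans (sym (rowsWithSum-rest t)) (trans (h t) (*-distribˡ-+ t (δ s t) (multiplicity t ss))))
  ρ : Fin d ↔ Fin (sum ss)
  ρ = proj₁ rec
  place : (Fin s ⊎ Fin d) → Fin s ⊎ Fin (sum ss)
  place = Sum.map id (ρ ⟨$⟩ʳ_)
  p : Fin n ↔ Fin (s + sum ss)
  p = ↔-sym +↔⊎ ↔-∘ ((↔-id (Fin s) ⊎-↔ ρ) ↔-∘ π)
  placed : ∀ z z′ → ⊕-entry (J s) (blockDiag ss) (place z) (place z′) ≡ ⊕-entry (J s) rest z z′
  placed (inj₁ _) (inj₁ _) = refl
  placed (inj₁ _) (inj₂ _) = refl
  placed (inj₂ _) (inj₁ _) = refl
  placed (inj₂ y) (inj₂ y′) = proj₂ rec y y′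
  entries : ∀ i j → (J s ⊕ blockDiag ss) (p ⟨$⟩ʳ i) (p ⟨$⟩ʳ j) ≡ B i j
  entries i j = begin
    (J s ⊕ blockDiag ss) (join s (sum ss) (place (Inverse.to π i))) (join s (sum ss) (place (Inverse.to π j)))
      ≡⟨ ⊕-join (J s) (blockDiag ss) (place (Inverse.to π i)) (place (Inverse.to π j)) ⟩
    ⊕-entry (J s) (blockDiag ss) (place (Inverse.to π i)) (place (Inverse.to π j))
      ≡⟨ placed (Inverse.to π i) (Inverse.to π j) ⟩
    ⊕-entry (J s) rest (Inverse.to π i) (Inverse.to π j)
      ≡⟨ entry (Inverse.to π i) (Inverse.to π j) ⟨
    B (Inverse.from π (Inverse.to π i)) (Inverse.from π (Inverse.to π j))
      ≡⟨ cong₂ B (Inverse.strictlyInverseʳ π i) (Inverse.strictlyInverseʳ π j) ⟩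
    B i j ∎
    where open ≡-Reasoning

multiplicity-replicate : ∀ t b k ss → multiplicity t (replicate b k ++ ss) ≡ b * δ k t + multiplicity t ss
multiplicity-replicate t zero k ss = refl
multiplicity-replicate t (suc b) k ss =
  trans (cong (δ k t +_) (multiplicity-replicate t b k ss)) (sym (+-assoc (δ k t) _ _))

multiplicity-Ksizes : ∀ t k a b → multiplicity t (Ksizes k a b) ≡ a * δ (suc k) t + b * δ k t
multiplicity-Ksizes t k a b = trans (multiplicity-replicate t a (suc k) (replicate b k))
  (cong (a * δ (suc k) t +_)
  (subst (λ ss → multiplicity t ss ≡ b * δ k t) (replicate-++-[] b k)
    (trans (multiplicity-replicate t b k []) (+-identityʳ _))))

All-replicate-++ : ∀ {P : ℕ → Set} b {k ss} → P k → All P ss → All P (replicate b k ++ ss)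
All-replicate-++ zero p ps = ps
All-replicate-++ (suc b) p ps = p ∷ All-replicate-++ b p ps

Ksizes-pos : ∀ k a b → 1 ≤ k → All (0 <_) (Ksizes k a b)
Ksizes-pos k a b k≥1 = All-replicate-++ a (s≤s z≤n)
  (subst (All (0 <_)) (replicate-++-[] b k) (All-replicate-++ b k≥1 []))

-- The excess `e` over `k` is 0 or 1 and sums to `suc k * a`, the number of rows of sum k + 1. The
-- indicator of a row sum `t` is affine in `e`; its negative part is moved to the other side.
rowsWithSum-two-values : ∀ n k a b (A : Mat n) → n ≡ suc k * a + k * b →
  sumFin n (rowSum n A) ≡ k * n + suc k * a → (∀ i → rowSum n A i ≡ k ⊎ rowSum n A i ≡ suc k) →
  ∀ t → rowsWithSum n A t ≡ t * multiplicity t (Ksizes k a b)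
rowsWithSum-two-values n k a b A n≡ sum-r two t = +-cancelʳ-≡ (suc k * a * δ k t) _ _ (begin
  rowsWithSum n A t + suc k * a * δ k t
    ≡⟨ cong (rowsWithSum n A t +_) (trans (*-comm _ (δ k t)) (trans (cong (δ k t *_) (sym sum-e))
        (sym (sum-*ˡ n (δ k t) e)))) ⟩
  rowsWithSum n A t + sumFin n (λ i → δ k t * e i)
    ≡⟨ sum-+ n _ _ ⟨
  sumFin n (λ i → δ (rowSum n A i) t + δ k t * e i)
    ≡⟨ sum-cong n row ⟩
  sumFin n (λ i → δ (suc k) t * e i + δ k t)
    ≡⟨ sum-+ n _ _ ⟩
  sumFin n (λ i → δ (suc k) t * e i) + sumFin n (λ _ → δ k t)
    ≡⟨ cong₂ _+_ (trans (sum-*ˡ n (δ (suc k) t) e) (cong (δ (suc k) t *_) sum-e)) (trans (sum-const n (δ k t))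
        (cong (_* δ k t) n≡)) ⟩
  δ (suc k) t * (suc k * a) + (suc k * a + k * b) * δ k t
    ≡⟨ regroup (δ (suc k) t) (δ k t) (suc k) k a b ⟩
  a * (suc k * δ (suc k) t) + b * (k * δ k t) + suc k * a * δ k t
    ≡⟨ cong (_+ suc k * a * δ k t) (cong₂ (λ x y → a * x + b * y) (*-δ (suc k) t) (*-δ k t)) ⟩
  a * (t * δ (suc k) t) + b * (t * δ k t) + suc k * a * δ k t
    ≡⟨ cong (_+ suc k * a * δ k t) (trans (factor t (δ (suc k) t) (δ k t) a b)
        (cong (t *_) (sym (multiplicity-Ksizes t k a b)))) ⟩
  t * multiplicity t (Ksizes k a b) + suc k * a * δ k t ∎)
  where
  open ≡-Reasoning
  e : Fin n → ℕ
  e i = rowSum n A i ∸ k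
  r≡k+e : ∀ i → rowSum n A i ≡ k + e i
  r≡k+e i with two i
  ... | inj₁ p = sym (m+[n∸m]≡n (≤-reflexive (sym p)))
  ... | inj₂ p = sym (m+[n∸m]≡n (≤-trans (n≤1+n k) (≤-reflexive (sym p))))
  sum-e : sumFin n e ≡ suc k * a
  sum-e = +-cancelˡ-≡ (k * n) _ _ (begin
    k * n + sumFin n e                  ≡⟨ cong (_+ sumFin n e) (trans (*-comm k n) (sym (sum-const n k))) ⟩
    sumFin n (λ _ → k) + sumFin n e     ≡⟨ sum-+ n (λ _ → k) e ⟨
    sumFin n (λ i → k + e i)            ≡⟨ sum-cong n r≡k+e ⟨
    sumFin n (rowSum n A)               ≡⟨ sum-r ⟩
    k * n + suc k * a                   ∎)
  row : ∀ i → δ (rowSum n A i) t + δ k t * e i ≡ δ (suc k) t * e i + δ k t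
  row i with two i
  ... | inj₁ p rewrite p | n∸n≡0 k = first (δ k t) (δ (suc k) t)
    where
    first : ∀ x y → x + x * 0 ≡ y * 0 + x
    first = solve-∀
  ... | inj₂ p rewrite p | m+n∸n≡m 1 k = second (δ k t) (δ (suc k) t)
    where
    second : ∀ x y → y + x * 1 ≡ y * 1 + x
    second = solve-∀
  regroup : ∀ x y z k a b → x * (z * a) + (z * a + k * b) * y ≡ a * (z * x) + b * (k * y) + z * a * y
  regroup = solve-∀
  factor : ∀ t x y a b → a * (t * x) + b * (t * y) ≡ t * (a * x + b * y)
  factor = solve-∀

rectangular⇒CombEquiv : ∀ n k a b (A : Mat n) → 1 ≤ k → 0 < perm n A → Rectangular A → n ≡ suc k * a + k * b →
  sumFin n (rowSum n A) ≡ k * n + suc k * a → (∀ i → rowSum n A i ≡ k ⊎ rowSum n A i ≡ suc k) →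
  CombEquiv A (Kmat k a b)
rectangular⇒CombEquiv n k a b A k≥1 pos rect n≡ sum-r two with transversal n A pos
-- Permuting columns by `v` preserves row sums and rectangularity and puts ones on the diagonal; the
-- column bijection of the equivalence undoes it.
... | v , diag with blocks (Ksizes k a b) (Ksizes-pos k a b k≥1) n (λ i j → A i (v ⟨$⟩ʳ j)) diag rect
      (λ t → trans (sum-cong n λ i → cong (λ r → δ r t) (sym (sum-permute n n v (λ j → b2n (A i j)))))
        (rowsWithSum-two-values n k a b A n≡ sum-r two t))
...   | p , e = p , p ↔-∘ ↔-sym v , λ i j → trans (e i (v ⟨$⟩ˡ j)) (cong (A i) (inverseʳ v))

-- The maximum

-- root N r stands for (r!)^(1/r), raised to the power N! to be a natural number when r ≤ N.
-- The value at 0 is immaterial: a matrix with a zero row has permanent 0.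
root : ℕ → ℕ → ℕ
root N zero = 1
root N (suc r) = (suc r !) ^ (N ! / suc r)

root-pos : ∀ N r → 0 < root N r
root-pos N zero = s≤s z≤n
root-pos N (suc r) = ^-pos (N ! / suc r) (1≤n! (suc r))

root-^ : ∀ N r → r ≤ N → root N r ^ r ≡ (r !) ^ (N !)
root-^ N zero _ = sym (^-zeroˡ (N !))
root-^ N (suc r) r≤N = trans (^-*-assoc (suc r !) (N ! / suc r) (suc r))
  (cong ((suc r !) ^_) (m/n*n≡m (∣-trans (m∣m*n (r !)) (m≤n⇒m!∣n! r≤N))))

maxPer : ℕ → ℕ → ℕ → ℕ
maxPer k a b = pow (fact (suc k)) a * pow (fact k) b

maxPer≡ : ∀ k a b → maxPer k a b ≡ (suc k !) ^ a * (k !) ^ b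
maxPer≡ k a b = cong₂ _*_ (trans (pow≡^ (fact (suc k)) a) (cong (_^ a) (fact≡! (suc k))))
                          (trans (pow≡^ (fact k) b) (cong (_^ b) (fact≡! k)))

maxPer-pos : ∀ k a b → 0 < maxPer k a b
maxPer-pos k a b = subst (0 <_) (sym (maxPer≡ k a b)) (*-mono-≤ (^-pos a (1≤n! (suc k))) (^-pos b (1≤n! k)))

module Bound (n k a b : ℕ) (k≥1 : 1 ≤ k) (A : Mat (suc n))
             (sum-r : ones (suc n) A ≡ k * suc n + suc k * a)
             (kn : suc k * suc n ≡ ones (suc n) A + k * b)
             (pos : 0 < perm (suc n) A) where
  -- `N` has to dominate the row sums and also k + 1, which may exceed the order, as for the
  -- all-ones matrix with k equal to the order.
  N = suc k + suc n
  L = N !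
  r = rowSum (suc n) A
  M = (suc k !) ^ a * (k !) ^ b
  k<N : suc k ≤ N
  k<N = m≤m+n (suc k) (suc n)
  n≤N : suc n ≤ N
  n≤N = m≤n+m (suc n) (suc k)

  open Brègman L N (1≤n! N) (root N) (root-pos N) (root-^ N)
  open Concavity L N (1≤n! N) (root N) (root-pos N) (root-^ N)
  open Tangent k k≥1 k<N
  open Rows (suc n) a b r (perm-pos⇒rowSum-pos n A pos) (λ i → ≤-trans (rowSum≤n (suc n) A i) n≤N) sum-r kn

  upper : perm (suc n) A ≤ M
  upper = ^-cancel-≤ L (1≤n! N) (≤-trans (brègman (suc n) n≤N A) prod-w-≤)

  rectangular : M ≤ perm (suc n) A → Rectangular A
  rectangular le = brègman-equality (suc n) n≤N A pos (≤-trans prod-w-≤ (^-monoˡ-≤ L le))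

  rowSums : M ≤ perm (suc n) A → ∀ i → r i ≡ k ⊎ r i ≡ suc k
  rowSums le = prod-w-equality (≤-trans (^-monoˡ-≤ L le) (brègman (suc n) n≤N A))

-- The order of `Kmat` is a sum over the block sizes, equal to `n` only propositionally.
resize : ∀ {m n} → m ≡ n → (B : Mat m) → ∃ λ (A : Mat n) → ones n A ≡ ones m B × perm n A ≡ perm m B
resize refl B = B , refl , refl

module Parameters (n τ k a b : ℕ) (n≥3 : 3 ≤ n) (k≥1 : 1 ≤ k)
                  (σ≡ : n * n ∸ τ ≡ k * n + suc k * a) (kn : suc k * n ≡ (n * n ∸ τ) + k * b) where

  n≡ : n ≡ suc k * a + k * b
  n≡ = +-cancelʳ-≡ (k * n) _ _ (trans kn (trans (cong (_+ k * b) σ≡) (rearrange (k * n) (suc k * a) (k * b))))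
    where
    rearrange : ∀ x y z → x + y + z ≡ y + z + x
    rearrange = solve-∀

  -- Subtraction is truncated: a larger τ would give σ = 0, whereas σ ≥ kn > 0.
  τ≤n² : τ ≤ n * n
  τ≤n² with ≤-total τ (n * n)
  ... | inj₁ le = le
  ... | inj₂ ge = contradiction (trans (sym σ≡) (m≤n⇒m∸n≡0 ge))
    (n>0⇒n≢0 (≤-trans (*-mono-≤ k≥1 (≤-trans (s≤s z≤n) n≥3)) (m≤m+n (k * n) _)))

  ones-InU : (A : Mat n) → InU n τ A → ones n A ≡ n * n ∸ τ
  ones-InU A z = trans (sym (m+n∸m≡n (zeros A) (ones n A))) (cong₂ _∸_ (zeros+ones n A) z)

  InU-ones : (A : Mat n) → ones n A ≡ n * n ∸ τ → InU n τ A
  InU-ones A o = begin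
    zeros A                               ≡⟨ m+n∸n≡m (zeros A) (ones n A) ⟨
    zeros A + ones n A ∸ ones n A         ≡⟨ cong₂ _∸_ (zeros+ones n A) o ⟩
    n * n ∸ (n * n ∸ τ)                   ≡⟨ m∸[m∸n]≡n τ≤n² ⟩
    τ                                     ∎
    where open ≡-Reasoning

  ones-K : ones _ (Kmat k a b) ≡ n * n ∸ τ
  ones-K = trans (ones-Kmat k a b) (trans (count k a b)
    (trans (cong (λ m → k * m + suc k * a) (sym n≡)) (sym σ≡)))
    where
    count : ∀ k a b → a * (suc k * suc k) + b * (k * k) ≡ k * (suc k * a + k * b) + suc k * a
    count = solve-∀

  size : sum (Ksizes k a b) ≡ n
  size = trans (sum-Ksizes k a b) (trans (cong₂ _+_ (*-comm a (suc k)) (*-comm b k)) (sym n≡))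

  attained : ∃ λ (A : Mat n) → InU n τ A × per A ≡ maxPer k a b
  attained with resize size (Kmat k a b)
  ... | A , o , p = A , InU-ones A (trans o ones-K) , trans (per≡perm n A) (trans p (perm-Kmat k a b))

  CombEquiv⇒per : (A : Mat n) → CombEquiv A (Kmat k a b) → per A ≡ maxPer k a b
  CombEquiv⇒per A (p , q , e) = trans (per≡perm n A)
    (trans (perm-permute n _ A (Kmat k a b) p q e) (perm-Kmat k a b))

per-≤-maxPer : ∀ n τ k a b → 3 ≤ n → 1 ≤ k → n * n ∸ τ ≡ k * n + suc k * a → suc k * n ≡ (n * n ∸ τ) + k * b →
  (A : Mat n) → InU n τ A → per A ≤ maxPer k a b
per-≤-maxPer n@(suc n′) τ k a b n≥3 k≥1 σ≡ kn A A∈U with n≡0∨n>0 (perm n A)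
... | inj₁ P≡0 = ≤-trans (≤-reflexive (trans (per≡perm n A) P≡0)) z≤n
... | inj₂ P>0 = subst₂ _≤_ (sym (per≡perm n A)) (sym (maxPer≡ k a b))
    (Bound.upper n′ k a b k≥1 A (trans o σ≡) (trans kn (cong (_+ k * b) (sym o))) P>0)
  where
  o = Parameters.ones-InU n τ k a b n≥3 k≥1 σ≡ kn A A∈U

per≡maxPer⇒CombEquiv : ∀ n τ k a b → 3 ≤ n → 1 ≤ k → n * n ∸ τ ≡ k * n + suc k * a →
  suc k * n ≡ (n * n ∸ τ) + k * b →
  (A : Mat n) → InU n τ A → per A ≡ maxPer k a b → CombEquiv A (Kmat k a b)
per≡maxPer⇒CombEquiv n@(suc n′) τ k a b n≥3 k≥1 σ≡ kn A A∈U eq =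
  rectangular⇒CombEquiv n k a b A k≥1 P>0 (rectangular M≤P) n≡ (trans o σ≡) (rowSums M≤P)
  where
  open Parameters n τ k a b n≥3 k≥1 σ≡ kn
  o = ones-InU A A∈U
  P≡ : perm n A ≡ maxPer k a b
  P≡ = trans (sym (per≡perm n A)) eq
  P>0 : 0 < perm n A
  P>0 = subst (0 <_) (sym P≡) (maxPer-pos k a b)
  M≤P : (suc k !) ^ a * (k !) ^ b ≤ perm n A
  M≤P = ≤-reflexive (trans (sym (maxPer≡ k a b)) (sym P≡))
  open Bound n′ k a b k≥1 A (trans o σ≡) (trans kn (cong (_+ k * b) (sym o))) P>0

-- The two equations, with `a` and `b` in ℕ, express the inequalities kn ≤ σ ≤ (k + 1) n and the two
-- congruences at once.
theorem1p5 : (n τ k a b : ℕ) → 3 ≤ n → 1 ≤ k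
    → n * n ∸ τ ≡ k * n + suc k * a
    → suc k * n ≡ (n * n ∸ τ) + k * b
    → IsMu n τ (pow (fact (suc k)) a * pow (fact k) b)
    × ((A : Mat n) → InU n τ A
    → (per A ≡ pow (fact (suc k)) a * pow (fact k) b) ⇔ CombEquiv A (Kmat k a b))
theorem1p5 n τ k a b n≥3 k≥1 σ≡ kn =
  (attained , per-≤-maxPer n τ k a b n≥3 k≥1 σ≡ kn) ,
  λ A A∈U → mk⇔ (per≡maxPer⇒CombEquiv n τ k a b n≥3 k≥1 σ≡ kn A A∈U) (CombEquiv⇒per A)
  where open Parameters n τ k a b n≥3 k≥1 σ≡ kn
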